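{- Consider a $k$-HST $T$ with $n$ leaves and maximum degree $\delta$. For any parameters $\nu \in (0, 1/6)$ and $k>1$, $T$ admits an oblivious $\nu$-reliable $\left(1 + \frac{2}{k-1}\right)$-spanner of size $n\cdot \delta\cdot \tilde{O}\left(\nu^{ -1}\cdot\log\log n\right)^{2}$ and lightness $\delta\cdot \tilde{O}(\nu^{ -1}\cdot\log\log n)^2$.
   Context: Logarithms are base 2; $\tilde{O}(s)=O(s)\cdot\log^{O(1)}(s)$, with universal hidden constants. $k$-HST: an ultrametric is a finite metric space $(X,d)$ with a bijection $\varphi$ from $X$ to the leaves of a rooted tree $T$ such that (1) each node $v\in T$ has a label $\Gamma_v\ge 0$, with $\Gamma_v=0$ iff $v$ is a leaf, and $\Gamma_v\ge\Gamma_u$ whenever $u$ is a child of $v$; (2) $d(x,y)=\Gamma_{\mathrm{lca}(\varphi(x),\varphi(y))}$, where $\mathrm{lca}$ is the least common ancestor. For $k\ge1$ it is a $k$-HST if moreover $\Gamma_v\ge k\cdot\Gamma_u$ whenever $u$ is a child of $v$. The $k$-HST is identified with its tree $T$; its points are the $n$ leaves of $T$. The degree of an internal node is its number of children (every internal node is assumed to have at least 2 children), and the maximum degree of $T$ is the maximum over internal nodes. Reliable spanners: let $(X,d_X)$ be a finite metric space. For a weighted graph $H$ on vertex set $X$, $d_H$ is its shortest path distance ($\infty$ between different components), $H[Y]$ is the subgraph induced by $Y\subseteq X$, and $H$ is dominating if $d_X(u,v)\le d_H(u,v)$ for all $u,v$. An oblivious $\nu$-reliable $t$-spanner of $(X,d_X)$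 is a probability distribution $\mathcal{D}$ over dominating weighted graphs on $X$ such that for every attack set $B\subseteq X$ and every $H\in\mathrm{supp}(\mathcal{D})$ there is a superset $B_H^+\supseteq B$ such that $d_{H[X\setminus B]}(x,y)\le t\cdot d_X(x,y)$ for all $x,y\notin B_H^+$, and $\mathbb{E}_{H\sim\mathcal{D}}[|B_H^+|]\le(1+\nu)|B|$. It has size $m$ and lightness $\phi$ if every $H\in\mathrm{supp}(\mathcal{D})$ has at most $m$ edges and lightness at most $\phi$, where the lightness of $H$ is $w(H)/w(\mathrm{MST}(X))$, i.e. the total edge weight of $H$ divided by the weight of a minimum spanning tree of $(X,d_X)$. -}

module Defs where

open import Algebra.Bundles using (CommutativeRing; Semiring)
import Algebra.Definitions.RawSemiring as RawSemiringDefinitions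
open import Data.Bool.Base using (Bool; true; false; _∧_; T)
open import Data.Bool.Properties using (∧-comm)
open import Data.Fin.Base using (Fin)
import Data.Fin.Properties as Fin
open import Data.Fin.Subset using (Subset; _⊆_; _∉_; ∁; ∣_∣)
open import Data.List.Base using (List; []; _∷_; length; map; filter; foldr; allFin; cartesianProduct)
open import Data.List.Relation.Unary.Unique.Propositional using (Unique)
open import Data.Nat.Base as ℕ using (ℕ)
open import Data.Product.Base using (Σ; ∃; _×_; _,_; proj₁; proj₂)
import Data.Vec.Functional as Vector
open import Data.Vec.Base using (lookup)
open import Function.Bundles using (_⇔_; _↔_; Inverse)
open import Level using (Level; _⊔_; suc)
open import Relation.Binary.Construct.Closure.ReflexiveTransitive using (Star; ε; _◅_)
import Relation.Binary.Construct.NonStrictToStrict as NonStrictToStrict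
open import Relation.Binary.Core using (Rel)
open import Relation.Binary.PropositionalEquality using (_≡_; refl; cong; cong₂)
open import Relation.Binary.Structures using (IsDecTotalOrder)
open import Relation.Nullary.Decidable.Core using (yes; no; T?; _×-dec_)
open import Relation.Nullary.Negation.Core using (¬_)
open import Relation.Unary using (Pred)

-- ℝ is given by its axioms as the (classical) complete ordered field, with
-- decidable order.  `archimedean` follows classically from `complete`, and
-- `log₂` is determined uniquely on positive arguments by its laws; both are
-- listed because the first yields an explicit bound and the second spares the
-- construction of logarithms from suprema.  `_⁻¹` and `log₂` are total, with
-- unspecified values at 0 and at nonpositive arguments respectively.
record RealNumbers (c ℓ₁ ℓ₂ : Level) : Set (suc (c ⊔ ℓ₁ ⊔ ℓ₂)) where
  infix  4 _≤_ _<_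
  infix  8 _⁻¹
  field
    commutativeRing : CommutativeRing c ℓ₁
  open CommutativeRing commutativeRing public
  open RawSemiringDefinitions (Semiring.rawSemiring semiring) public
    using (sum; _^_) renaming (_×_ to _·_)

  field
    _≤_             : Rel Carrier ℓ₂
    isDecTotalOrder : IsDecTotalOrder _≈_ _≤_

  _<_ : Rel Carrier (ℓ₁ ⊔ ℓ₂)
  _<_ = NonStrictToStrict._<_ _≈_ _≤_

  IsUpperBound : ∀ {ℓ} → Pred Carrier ℓ → Pred Carrier (c ⊔ ℓ ⊔ ℓ₂)
  IsUpperBound S u = ∀ x → S x → x ≤ u

  IsSupremum : ∀ {ℓ} → Pred Carrier ℓ → Pred Carrier (c ⊔ ℓ ⊔ ℓ₂)
  IsSupremum S s = IsUpperBound S s × (∀ u → IsUpperBound S u → s ≤ u)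

  fromℕ : ℕ → Carrier
  fromℕ m = m · 1#

  field
    1≉0             : ¬ (1# ≈ 0#)
    _⁻¹             : Carrier → Carrier
    ⁻¹-inverseʳ     : ∀ x → ¬ (x ≈ 0#) → x * x ⁻¹ ≈ 1#

    +-monoˡ-≤       : ∀ x y z → x ≤ y → x + z ≤ y + z
    *-nonNegative   : ∀ x y → 0# ≤ x → 0# ≤ y → 0# ≤ x * y
    archimedean     : ∀ x → ∃ λ m → x < fromℕ m
    complete        : (S : Pred Carrier (c ⊔ ℓ₁ ⊔ ℓ₂)) →
                      ∃ S → ∃ (IsUpperBound S) → ∃ (IsSupremum S)

    log₂            : Carrier → Carrier
    log₂-cong       : ∀ x y → 0# < x → x ≈ y → log₂ x ≈ log₂ y
    log₂-mono-<     : ∀ x y → 0# < x → x < y → log₂ x < log₂ y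
    log₂-*          : ∀ x y → 0# < x → 0# < y → log₂ (x * y) ≈ log₂ x + log₂ y
    log₂-2          : log₂ (fromℕ 2) ≈ 1#

module Spanners {c ℓ₁ ℓ₂ : Level} (ℝ : RealNumbers c ℓ₁ ℓ₂) where
  open RealNumbers ℝ hiding (refl; trans; sym)

  record FiniteMetricSpace : Set (c ⊔ ℓ₁ ⊔ ℓ₂) where
    field
      size     : ℕ
      d        : Fin size → Fin size → Carrier
      d≥0      : ∀ x y → 0# ≤ d x y
      d≈0⇔≡    : ∀ x y → d x y ≈ 0# ⇔ x ≡ y
      d-sym    : ∀ x y → d x y ≈ d y x
      triangle : ∀ x y z → d x z ≤ d x y + d y z

  data Tree : Set c where
    node : (Γ : Carrier) {m : ℕ} (children : Fin m → Tree) → Tree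

  data Node : Tree → Set c where
    root  : ∀ {t} → Node t
    child : ∀ {Γ m} {ts : Fin m → Tree} (i : Fin m) → Node (ts i) → Node (node Γ ts)

  label : ∀ {t} → Node t → Carrier
  label {node Γ _} root = Γ
  label (child _ v)     = label v

  degree : ∀ {t} → Node t → ℕ
  degree {node _ {m} _} root = m
  degree (child _ v)         = degree v

  childOf : ∀ {t} (v : Node t) → Fin (degree v) → Node t
  childOf {node _ _} root i = child i root
  childOf (child j v)     i = child j (childOf v i)

  IsLeaf : ∀ {t} → Node t → Set
  IsLeaf v = degree v ≡ 0

  Leaf : Tree → Set c
  Leaf t = Σ (Node t) IsLeaf

  lca : ∀ {t} → Node t → Node t → Node t
  lca root        _           = root
  lca (child _ _) root        = root
  lca (child i u) (child j v) with i Fin.≟ j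
  ... | yes refl = child i (lca u v)
  ... | no _     = root

  -- Leaves contribute 0, so this is the maximum over the internal nodes
  -- (and 0 if there are none).
  maxDegree : Tree → ℕ
  maxDegree (node _ {m} ts) = Vector.foldr ℕ._⊔_ m (λ i → maxDegree (ts i))

  record IsUltrametric (X : FiniteMetricSpace) (t : Tree) : Set (c ⊔ ℓ₁ ⊔ ℓ₂) where
    open FiniteMetricSpace X
    field
      label≥0        : (v : Node t) → 0# ≤ label v
      label≈0⇔leaf   : (v : Node t) → label v ≈ 0# ⇔ IsLeaf v
      label-antitone : (v : Node t) (i : Fin (degree v)) → label (childOf v i) ≤ label v
      degree≥2       : (v : Node t) → ¬ IsLeaf v → 2 ℕ.≤ degree v
      φ              : Fin size ↔ Leaf t
      d≈label-lca    : ∀ x y → d x y ≈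
                       label (lca (proj₁ (Inverse.to φ x)) (proj₁ (Inverse.to φ y)))

  record IsHST (k : Carrier) (X : FiniteMetricSpace) (t : Tree) : Set (c ⊔ ℓ₁ ⊔ ℓ₂) where
    field
      isUltrametric   : IsUltrametric X t
      label-separated : (v : Node t) (i : Fin (degree v)) →
                        k * label (childOf v i) ≤ label v

  -- Simple undirected graphs; values of `w` off the edges are irrelevant.
  record WeightedGraph (n : ℕ) : Set (c ⊔ ℓ₁ ⊔ ℓ₂) where
    field
      adj     : Fin n → Fin n → Bool
      adj-irr : ∀ x → adj x x ≡ false
      adj-sym : ∀ x y → adj x y ≡ adj y x
      w       : Fin n → Fin n → Carrier
      w-sym   : ∀ x y → T (adj x y) → w x y ≈ w y x
      w≥0     : ∀ x y → T (adj x y) → 0# ≤ w x y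

  module _ {n : ℕ} (G : WeightedGraph n) where
    open WeightedGraph G

    Edge : Rel (Fin n) _
    Edge x y = T (adj x y)

    edges : List (Fin n × Fin n)
    edges = filter (λ (x , y) → (x Fin.<? y) ×-dec T? (adj x y))
                   (cartesianProduct (allFin n) (allFin n))

    edgeCount : ℕ
    edgeCount = length edges

    weight : Carrier
    weight = foldr _+_ 0# (map (λ (x , y) → w x y) edges)

    Path : Rel (Fin n) _
    Path = Star Edge

    pathLength : ∀ {x y} → Path x y → Carrier
    pathLength ε                      = 0#
    pathLength (_◅_ {x} {y} _ p)      = w x y + pathLength p

    vertices : ∀ {x y} → Path x y → List (Fin n)
    vertices {x} ε       = x ∷ []
    vertices {x} (_ ◅ p) = x ∷ vertices p

    -- The graph distance is a minimum over finitely many simple paths, and is ∞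
    -- if there are none; so it is bounded above by a real r iff some path has
    -- length at most r, and bounded below by r iff all paths have length at
    -- least r.
    Dist≤ : Fin n → Fin n → Carrier → Set ℓ₂
    Dist≤ x y r = Σ (Path x y) λ p → pathLength p ≤ r

    Dist≥ : Fin n → Fin n → Carrier → Set ℓ₂
    Dist≥ x y r = (p : Path x y) → r ≤ pathLength p

    Connected : Set
    Connected = ∀ x y → Path x y

    -- A cycle is a simple path on at least three vertices together with an
    -- edge joining its endpoints.
    Acyclic : Set
    Acyclic = ∀ {x y} (p : Path x y) → Unique (vertices p) →
              3 ℕ.≤ length (vertices p) → ¬ Edge y x

    -- The induced subgraph is kept on all of Fin n, with the vertices outside Y
    -- isolated; this does not affect distances between vertices of Y.
    induced : Subset n → WeightedGraph n
    induced Y = record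
      { adj     = λ x y → adj x y ∧ (lookup Y x ∧ lookup Y y)
      ; adj-irr = λ x → cong (_∧ (lookup Y x ∧ lookup Y x)) (adj-irr x)
      ; adj-sym = λ x y → cong₂ _∧_ (adj-sym x y) (∧-comm (lookup Y x) (lookup Y y))
      ; w       = w
      ; w-sym   = λ x y e → w-sym x y (∧-left e)
      ; w≥0     = λ x y e → w≥0 x y (∧-left e)
      }
      where
      ∧-left : ∀ {a b} → T (a ∧ b) → T a
      ∧-left {true} _ = _

  module _ (X : FiniteMetricSpace) where
    open FiniteMetricSpace X

    Dominating : WeightedGraph size → Set ℓ₂
    Dominating H = ∀ x y → Dist≥ H x y (d x y)

    record IsSpanningTree (M : WeightedGraph size) : Set (c ⊔ ℓ₁ ⊔ ℓ₂) where
      field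
        weights   : ∀ x y → Edge M x y → WeightedGraph.w M x y ≈ d x y
        connected : Connected M
        acyclic   : Acyclic M

    IsMST : WeightedGraph size → Set (c ⊔ ℓ₁ ⊔ ℓ₂)
    IsMST M = IsSpanningTree M × (∀ M′ → IsSpanningTree M′ → weight M ≤ weight M′)

    -- w(H) / w(MST(X)) ≤ φ, multiplied out so as to make sense also for a
    -- one-point space, whose minimum spanning tree has weight 0.
    Lightness≤ : WeightedGraph size → Carrier → Set (c ⊔ ℓ₁ ⊔ ℓ₂)
    Lightness≤ H φ = ∀ M → IsMST M → weight H ≤ φ * weight M

  -- Only finitely supported distributions; their support is listed by `graph`.
  record Distribution (n : ℕ) : Set (c ⊔ ℓ₁ ⊔ ℓ₂) where
    field
      supportSize : ℕ
      graph       : Fin supportSize → WeightedGraph n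
      prob        : Fin supportSize → Carrier
      prob>0      : ∀ i → 0# < prob i
      prob-total  : sum prob ≈ 1#

    expectation : (Fin supportSize → Carrier) → Carrier
    expectation f = sum (λ i → prob i * f i)

  record IsObliviousReliableSpanner
      (X : FiniteMetricSpace) (ν t : Carrier)
      (D : Distribution (FiniteMetricSpace.size X)) : Set (c ⊔ ℓ₁ ⊔ ℓ₂) where
    open FiniteMetricSpace X
    open Distribution D
    field
      dominating : ∀ i → Dominating X (graph i)
      reliable   : (B : Subset size) →
        Σ (Fin supportSize → Subset size) λ B⁺ →
          (∀ i → B ⊆ B⁺ i) ×
          (∀ i x y → x ∉ B⁺ i → y ∉ B⁺ i →
             Dist≤ (induced (graph i) (∁ B)) x y (t * d x y)) ×
          (expectation (λ i → fromℕ ∣ B⁺ i ∣) ≤ (1# + ν) * fromℕ ∣ B ∣)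

  HasSize≤ : ∀ {n} → Distribution n → Carrier → Set ℓ₂
  HasSize≤ D m = ∀ i → fromℕ (edgeCount (graph i)) ≤ m
    where open Distribution D

  HasLightness≤ : (X : FiniteMetricSpace) → Distribution (FiniteMetricSpace.size X) →
                  Carrier → Set (c ⊔ ℓ₁ ⊔ ℓ₂)
  HasLightness≤ X D φ = ∀ i → Lightness≤ X (graph i) φ
    where open Distribution D

  Õ[_,_] : ℕ → ℕ → Carrier → Carrier
  Õ[ C , e ] s = fromℕ C * s * log₂ s ^ e

  -- log log n is positive only for n ≥ 3; smaller n are treated as 3.
  loglog : ℕ → Carrier
  loglog n = log₂ (log₂ (fromℕ (n ℕ.⊔ 3)))

{-# OPTIONS --safe #-}

-- Every node v gets a random net Z_v of l of its leaves, and at every internal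
-- node the nets of the node and of its children are joined into a clique.  If
-- every net above x and y meets the complement of B, then x climbs through
-- surviving net points to a child of lca(x, y), crosses to the sibling above y
-- and descends; as labels decrease geometrically, this costs at most
-- (1 + 2/(k-1)) d(x, y).  B⁺ consists of the leaves below nodes whose net lies
-- in B.
--
-- To avoid a union bound over long root-to-leaf paths, nodes whose sizes agree
-- up to a factor 1 + O(ν) share the net of the lowest of them, its anchor.  An
-- anchor with less than a fraction 1 - O(ν) of its leaves in B dies with
-- probability at most (1 - O(ν))^l, while those with more contribute only
-- O(ν)|B| to B⁺ \ B.  Each leaf lies below O(ν⁻¹ log n) anchors, so
-- l = Õ(ν⁻¹ log log n) samples suffice.
--
-- For the lightness, every edge {x, y} of a spanning tree leaves the subtrees
-- between x (or y) and lca(x, y), over which the label differences telescope to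
-- d(x, y), and every proper subtree is left by some edge.
module Submission where

open import Defs
open import Algebra.Bundles using (CommutativeSemiring)
import Algebra.Properties.CommutativeSemigroup
import Algebra.Properties.Ring
import Algebra.Properties.Semiring.Mult
import Algebra.Solver.Ring.NaturalCoefficients.Default
open import Data.Bool.Base using (Bool; true; false; _∧_; if_then_else_; T; not)
open import Data.Bool.ListAction using (all)
import Data.Bool.Properties as Bool
open import Data.Fin.Base as Fin using (Fin; toℕ)
import Data.Fin.Properties as Fin
open import Data.Fin.Subset as Subset using (Subset; inside; outside; ∣_∣; ∁)
open import Data.List.Base using (List; []; _∷_; _++_; map; length; lookup; concatMap; filter; foldr; tabulate; allFin; upTo; applyUpTo; cartesianProduct)
import Data.List.Membership.DecPropositional as DecMembership
open import Data.List.Membership.Propositional using (_∈_; _∉_; find; lose)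
open import Data.List.Membership.Propositional.Properties using (∈-∃++; ∈-++⁺ˡ; ∈-++⁺ʳ; ∈-++⁻; ∈-map⁺; ∈-map⁻; ∈-concatMap⁺; ∈-concatMap⁻; ∈-cartesianProduct⁺; ∈-cartesianProduct⁻; ∈-filter⁺; ∈-filter⁻; ∈-allFin; ∈-lookup)
open import Data.List.Membership.Propositional.Properties.WithK using (unique∧set⇒bag)
open import Data.List.Properties using (length-++; length-map; length-tabulate)
open import Data.List.Relation.Binary.BagAndSetEquality using (∼bag⇒↭)
open import Data.List.Relation.Binary.Permutation.Propositional as Perm using (_↭_; ↭-trans; ↭-refl; ↭-prep)
open import Data.List.Relation.Binary.Permutation.Propositional.Properties using (∈-resp-↭; shift; ↭-length)
import Data.List.Relation.Unary.All as All
import Data.List.Relation.Unary.All.Properties as All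
import Data.List.Relation.Unary.AllPairs as AllPairs
import Data.List.Relation.Unary.AllPairs.Properties as AllPairs
open import Data.List.Relation.Unary.Any using (here; there)
open import Data.List.Relation.Unary.Unique.Propositional using (Unique; []; _∷_)
import Data.List.Relation.Unary.Unique.Propositional.Properties as Unique
open import Data.Nat.Base as ℕ using (ℕ; zero; suc; z≤n; s≤s; _!)
open import Data.Nat.Divisibility using (_∣_; ∣-trans; m∣m*n; m≤n⇒m!∣n!)
import Data.Nat.Properties as ℕ
open import Data.Nat.Tactic.RingSolver using (solve-∀)
open import Data.Product.Base using (Σ; ∃; _×_; _,_; proj₁; proj₂; swap)
open import Data.Product.Properties using (≡-dec)
open import Data.Sum.Base using (inj₁; inj₂)
import Data.Vec.Base as Vec
import Data.Vec.Functional as Vector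
import Data.Vec.Properties as Vec
open import Function.Base using (_∘_; id)
open import Function.Bundles using (Equivalence; Inverse; mk⇔; _⇔_)
open import Level using (Level; _⊔_)
open import Relation.Binary.Bundles using (Poset)
open import Relation.Binary.Construct.Closure.ReflexiveTransitive using (ε; _◅_)
open import Relation.Binary.Core using (Rel)
open import Relation.Binary.Definitions using (tri<; tri≈; tri>)
open import Relation.Binary.PropositionalEquality as ≡ using (_≡_; _≢_; cong; cong₂; subst)
import Relation.Binary.Reasoning.PartialOrder
open import Relation.Binary.Structures using (IsPartialOrder; IsDecTotalOrder)
open import Relation.Nullary.Decidable using (dec-true; dec-false; does-⇔)
open import Relation.Nullary.Decidable.Core using (Dec; does; yes; no; T?; ¬?; _×-dec_)
open import Relation.Nullary.Negation.Core using (¬_; contradiction)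
open import Relation.Unary using (Pred; Decidable)

-- The randomness is one uniform list `ω` of numbers below `n !`, shared by the whole hierarchy: a
-- node with s leaves reads a number r as its leaf of index r mod s, which is exactly uniform
-- because s divides `n !`. The nets of different nodes are thus strongly correlated, but
-- reliability only bounds an expectation, which is additive over anchors, so independence is needed
-- only among the samples within one net. Probabilities become cardinalities, and the analysis stays
-- in the natural numbers until the final division.
--
-- The constants fit together as follows. With 3/ν ≤ p ≤ 3/ν + 1, nodes sharing an anchor agree in
-- size up to the factor (p+2)/(p+1), and an anchor counts as full if at least a fraction p/(p+1) of
-- its leaves lies in B. A dead node with a full anchor therefore has at most (p+2)/p leaves per
-- leaf in B, the other anchors add at most |B|/p in expectation, and (p+3)/p ≤ 1 + ν.

private
  variable
    α β : Level
    A : Set α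
    B : Set β

-- Finite sums over lists, for counting in ℕ as well as for real weights.

module Sums {c ℓ₁ ℓ₂} (R : CommutativeSemiring c ℓ₁)
            (_≤_ : Rel (CommutativeSemiring.Carrier R) ℓ₂)
            (isPartialOrder : IsPartialOrder (CommutativeSemiring._≈_ R) _≤_)
            (+-mono-≤ : ∀ {x y u v} → x ≤ y → u ≤ v →
                        CommutativeSemiring._+_ R x u ≤ CommutativeSemiring._+_ R y v)
            where
  open CommutativeSemiring R
  open IsPartialOrder isPartialOrder using () renaming (refl to ≤-refl; reflexive to ≤-reflexive; trans to ≤-trans)
  open Algebra.Properties.CommutativeSemigroup +-commutativeSemigroup using (interchange; x∙yz≈y∙xz)

  poset : Poset c ℓ₁ ℓ₂
  poset = record { isPartialOrder = isPartialOrder }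

  open Relation.Binary.Reasoning.PartialOrder poset

  ∑ : List A → (A → Carrier) → Carrier
  ∑ []       f = 0#
  ∑ (x ∷ xs) f = f x + ∑ xs f

  ∑-cong : ∀ (xs : List A) {f g} → (∀ x → f x ≈ g x) → ∑ xs f ≈ ∑ xs g
  ∑-cong []       e = refl
  ∑-cong (x ∷ xs) e = +-cong (e x) (∑-cong xs e)

  ∑-mono : ∀ (xs : List A) {f g} → (∀ {x} → x ∈ xs → f x ≤ g x) → ∑ xs f ≤ ∑ xs g
  ∑-mono []       e = ≤-refl
  ∑-mono (x ∷ xs) e = +-mono-≤ (e (here ≡.refl)) (∑-mono xs (e ∘ there))

  ∑-++ : ∀ (xs ys : List A) f → ∑ (xs ++ ys) f ≈ ∑ xs f + ∑ ys f
  ∑-++ []       ys f = sym (+-identityˡ _)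
  ∑-++ (x ∷ xs) ys f = trans (+-congˡ (∑-++ xs ys f)) (sym (+-assoc _ _ _))

  ∑-map : ∀ (g : A → B) xs f → ∑ (map g xs) f ≈ ∑ xs (f ∘ g)
  ∑-map g []       f = refl
  ∑-map g (x ∷ xs) f = +-congˡ (∑-map g xs f)

  ∑-concatMap : ∀ (g : A → List B) xs f → ∑ (concatMap g xs) f ≈ ∑ xs λ x → ∑ (g x) f
  ∑-concatMap g []       f = refl
  ∑-concatMap g (x ∷ xs) f = trans (∑-++ (g x) (concatMap g xs) f) (+-congˡ (∑-concatMap g xs f))

  ∑-cartesianProduct : ∀ (xs : List A) (ys : List B) f →
                       ∑ (cartesianProduct xs ys) f ≈ ∑ xs λ x → ∑ ys λ y → f (x , y)
  ∑-cartesianProduct []       ys f = refl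
  ∑-cartesianProduct (x ∷ xs) ys f = trans
    (∑-++ (map (x ,_) ys) (cartesianProduct xs ys) f)
    (+-cong (∑-map (x ,_) ys f) (∑-cartesianProduct xs ys f))

  ∑-zero : ∀ (xs : List A) → ∑ xs (λ _ → 0#) ≈ 0#
  ∑-zero []       = refl
  ∑-zero (x ∷ xs) = trans (+-identityˡ _) (∑-zero xs)

  ∑-+ : ∀ (xs : List A) f g → ∑ xs (λ x → f x + g x) ≈ ∑ xs f + ∑ xs g
  ∑-+ []       f g = sym (+-identityˡ _)
  ∑-+ (x ∷ xs) f g = trans (+-congˡ (∑-+ xs f g)) (interchange _ _ _ _)

  ∑-swap : ∀ (xs : List A) (ys : List B) (f : A → B → Carrier) →
           ∑ xs (λ x → ∑ ys (f x)) ≈ ∑ ys λ y → ∑ xs λ x → f x y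
  ∑-swap []       ys f = sym (∑-zero ys)
  ∑-swap (x ∷ xs) ys f = trans (+-congˡ (∑-swap xs ys f)) (sym (∑-+ ys (f x) _))

  ∑-*ˡ : ∀ u (xs : List A) f → u * ∑ xs f ≈ ∑ xs λ x → u * f x
  ∑-*ˡ u []       f = zeroʳ u
  ∑-*ˡ u (x ∷ xs) f = trans (distribˡ u _ _) (+-congˡ (∑-*ˡ u xs f))

  ∑-*ʳ : ∀ u (xs : List A) f → ∑ xs f * u ≈ ∑ xs λ x → f x * u
  ∑-*ʳ u []       f = zeroˡ u
  ∑-*ʳ u (x ∷ xs) f = trans (distribʳ u _ _) (+-congˡ (∑-*ʳ u xs f))

  ∑-↭ : ∀ {xs ys : List A} f → xs ↭ ys → ∑ xs f ≈ ∑ ys f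
  ∑-↭ f Perm.refl           = refl
  ∑-↭ f (Perm.prep x p)     = +-congˡ (∑-↭ f p)
  ∑-↭ f (Perm.swap x y p)   = trans (+-congˡ (+-congˡ (∑-↭ f p))) (x∙yz≈y∙xz _ _ _)
  ∑-↭ f (Perm.trans p q)    = trans (∑-↭ f p) (∑-↭ f q)

  ∑-nonNegative : ∀ (xs : List A) {f} → (∀ {x} → x ∈ xs → 0# ≤ f x) → 0# ≤ ∑ xs f
  ∑-nonNegative xs {f} f≥0 = begin
    0#              ≈⟨ ∑-zero xs ⟨
    ∑ xs (λ _ → 0#) ≤⟨ ∑-mono xs f≥0 ⟩
    ∑ xs f          ∎

  term≤∑ : ∀ {xs : List A} {f x} → (∀ {x} → x ∈ xs → 0# ≤ f x) → x ∈ xs → f x ≤ ∑ xs f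
  term≤∑ {xs = _ ∷ xs} {f} {x} f≥0 (here ≡.refl) = begin
    f x          ≈⟨ +-identityʳ _ ⟨
    f x + 0#     ≤⟨ +-mono-≤ ≤-refl (∑-nonNegative xs (f≥0 ∘ there)) ⟩
    f x + ∑ xs f ∎
  term≤∑ {xs = y ∷ xs} {f} {x} f≥0 (there x∈xs) = begin
    f x          ≈⟨ +-identityˡ _ ⟨
    0# + f x     ≤⟨ +-mono-≤ (f≥0 (here ≡.refl)) (term≤∑ (f≥0 ∘ there) x∈xs) ⟩
    f y + ∑ xs f ∎

  ∑-nonPositive : ∀ (xs : List A) {f} → (∀ {x} → x ∈ xs → f x ≤ 0#) → ∑ xs f ≤ 0#
  ∑-nonPositive xs {f} f≤0 = begin
    ∑ xs f          ≤⟨ ∑-mono xs f≤0 ⟩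
    ∑ xs (λ _ → 0#) ≈⟨ ∑-zero xs ⟩
    0#              ∎

  ∑≤term : ∀ {xs : List A} {f x} → Unique xs → x ∈ xs → (∀ y → y ≢ x → f y ≤ 0#) → ∑ xs f ≤ f x
  ∑≤term {xs = _ ∷ xs} {f} {x} (x∉xs ∷ _) (here ≡.refl) f≤0 = begin
    f x + ∑ xs f ≤⟨ +-mono-≤ ≤-refl (∑-nonPositive xs λ y∈xs → f≤0 _ λ { ≡.refl → All.lookup x∉xs y∈xs ≡.refl }) ⟩
    f x + 0#     ≈⟨ +-identityʳ _ ⟩
    f x          ∎
  ∑≤term {xs = y ∷ xs} {f} {x} (y∉xs ∷ uniq) (there x∈xs) f≤0 = begin
    f y + ∑ xs f ≤⟨ +-mono-≤ (f≤0 y λ { ≡.refl → All.lookup y∉xs x∈xs ≡.refl }) (∑≤term uniq x∈xs f≤0) ⟩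
    0# + f x     ≈⟨ +-identityˡ _ ⟩
    f x          ∎

-- Counting sample sequences; size classes and anchors.

module Sampling where
  open import Data.Nat.Base hiding (_/_)
  open import Data.Nat.DivMod using (_mod_; _%_; [m+n]%n≡m%n; m<n⇒m%n≡m; m%n<n)
  open import Data.Nat.Divisibility using (_∣_; divides)
  open import Data.Nat.Properties
  open import Relation.Binary.PropositionalEquality using (_≡_; refl; sym; trans; cong; cong₂; module ≡-Reasoning)

  open module ∑ℕ = Sums +-*-commutativeSemiring _≤_ ≤-isPartialOrder +-mono-≤
    public using () renaming (∑ to ∑ℕ)

  ⟦_⟧ : Bool → ℕ
  ⟦ true ⟧  = 1
  ⟦ false ⟧ = 0

  length-concatMap : ∀ {Y : Set β} (f : A → List Y) xs → length (concatMap f xs) ≡ ∑ℕ xs (length ∘ f)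
  length-concatMap f []       = refl
  length-concatMap f (x ∷ xs) = trans (length-++ (f x)) (cong (length (f x) +_) (length-concatMap f xs))

  applyUpTo-∑-+ : ∀ (g : ℕ → A) f a b →
    ∑ℕ (applyUpTo g (a + b)) f ≡ ∑ℕ (applyUpTo g a) f + ∑ℕ (applyUpTo (g ∘ (a +_)) b) f
  applyUpTo-∑-+ g f zero    b = refl
  applyUpTo-∑-+ g f (suc a) b = trans
    (cong (f (g 0) +_) (applyUpTo-∑-+ (g ∘ suc) f a b))
    (sym (+-assoc (f (g 0)) _ _))

  applyUpTo-∑-cong : ∀ (g h : ℕ → A) f k → (∀ i → f (g i) ≡ f (h i)) →
    ∑ℕ (applyUpTo g k) f ≡ ∑ℕ (applyUpTo h k) f
  applyUpTo-∑-cong g h f zero    e = refl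
  applyUpTo-∑-cong g h f (suc k) e = cong₂ _+_ (e 0) (applyUpTo-∑-cong (g ∘ suc) (h ∘ suc) f k (e ∘ suc))

  applyUpTo-∑-lookup : ∀ (g : ℕ → ℕ) (f : ℕ → ℕ) (xs : List A) F → (∀ i → f (g (toℕ i)) ≡ F (lookup xs i)) →
    ∑ℕ (applyUpTo g (length xs)) f ≡ ∑ℕ xs F
  applyUpTo-∑-lookup g f []       F e = refl
  applyUpTo-∑-lookup g f (x ∷ xs) F e = cong₂ _+_ (e Fin.zero) (applyUpTo-∑-lookup (g ∘ suc) f xs F (e ∘ Fin.suc))

  -- This is the uniformity of residues modulo `s` when the range is a multiple of `s`.
  periodic-∑ : ∀ q s f → (∀ r → f (s + r) ≡ f r) → ∑ℕ (upTo (q * s)) f ≡ q * ∑ℕ (upTo s) f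
  periodic-∑ zero    s f e = refl
  periodic-∑ (suc q) s f e = trans (applyUpTo-∑-+ id f s (q * s))
    (cong (∑ℕ (upTo s) f +_) (trans (applyUpTo-∑-cong (s +_) id f (q * s) e) (periodic-∑ q s f e)))

  -- The sample space of `l` independent uniform draws below `N`, in which probabilities are
  -- cardinalities relative to `N ^ l`.
  sequences : ℕ → ℕ → List (List ℕ)
  sequences N zero    = [] ∷ []
  sequences N (suc l) = concatMap (λ r → map (r ∷_) (sequences N l)) (upTo N)

  ⟦∧⟧ : ∀ u v → ⟦ u ∧ v ⟧ ≡ ⟦ u ⟧ * ⟦ v ⟧
  ⟦∧⟧ true  v = sym (+-identityʳ _)
  ⟦∧⟧ false v = refl

  -- Independence of the draws in counting form: peeling off the first entry factors out one sum.
  ∑-sequences : ∀ N l (f : ℕ → Bool) →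
    ∑ℕ (sequences N l) (λ ω → ⟦ all f ω ⟧) ≡ ∑ℕ (upTo N) (λ r → ⟦ f r ⟧) ^ l
  ∑-sequences N zero    f = refl
  ∑-sequences N (suc l) f = begin-equality
    ∑ℕ (concatMap (λ r → map (r ∷_) (sequences N l)) (upTo N)) (λ ω → ⟦ all f ω ⟧)
      ≡⟨ ∑ℕ.∑-concatMap _ (upTo N) _ ⟩
    ∑ℕ (upTo N) (λ r → ∑ℕ (map (r ∷_) (sequences N l)) (λ ω → ⟦ all f ω ⟧))
      ≡⟨ ∑ℕ.∑-cong (upTo N) (λ r → trans (∑ℕ.∑-map (r ∷_) (sequences N l) _)
           (trans (∑ℕ.∑-cong (sequences N l) λ ω → ⟦∧⟧ (f r) (all f ω))
             (trans (sym (∑ℕ.∑-*ˡ ⟦ f r ⟧ (sequences N l) _)) (cong (⟦ f r ⟧ *_) (∑-sequences N l f))))) ⟩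
    ∑ℕ (upTo N) (λ r → ⟦ f r ⟧ * ∑ℕ (upTo N) (λ r → ⟦ f r ⟧) ^ l)
      ≡⟨ ∑ℕ.∑-*ʳ (∑ℕ (upTo N) (λ r → ⟦ f r ⟧) ^ l) (upTo N) _ ⟨
    ∑ℕ (upTo N) (λ r → ⟦ f r ⟧) * ∑ℕ (upTo N) (λ r → ⟦ f r ⟧) ^ l ∎
    where open ≤-Reasoning

  ∑-applyUpTo-1 : ∀ (g : ℕ → ℕ) N → ∑ℕ (applyUpTo g N) (λ _ → 1) ≡ N
  ∑-applyUpTo-1 g zero    = refl
  ∑-applyUpTo-1 g (suc N) = cong suc (∑-applyUpTo-1 (g ∘ suc) N)

  all-true : (xs : List A) → all (λ _ → true) xs ≡ true
  all-true []       = refl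
  all-true (x ∷ xs) = all-true xs

  ∑-1 : (xs : List A) → ∑ℕ xs (λ _ → 1) ≡ length xs
  ∑-1 []       = refl
  ∑-1 (x ∷ xs) = cong suc (∑-1 xs)

  length-sequences : ∀ N l → length (sequences N l) ≡ N ^ l
  length-sequences N l = begin-equality
    length (sequences N l)                                ≡⟨ ∑-1 (sequences N l) ⟨
    ∑ℕ (sequences N l) (λ _ → 1)                          ≡⟨ ∑ℕ.∑-cong (sequences N l) (λ ω → cong ⟦_⟧ (all-true ω)) ⟨
    ∑ℕ (sequences N l) (λ ω → ⟦ all (λ _ → true) ω ⟧)     ≡⟨ ∑-sequences N l (λ _ → true) ⟩
    ∑ℕ (upTo N) (λ _ → 1) ^ l                             ≡⟨ cong (_^ l) (∑-applyUpTo-1 id N) ⟩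
    N ^ l                                                 ∎
    where open ≤-Reasoning

  -- Sizes are rounded down to the greedy sequence of bases in which each term
  -- exceeds (M + 1) / M times its predecessor.
  module Classes (M : ℕ) where
    base : ℕ → ℕ
    -- A convention that starts the bases at 1: size 1 meets the threshold and so gets base 1 and
    -- class 0.
    base zero    = 1
    base (suc s) with M * suc s ≤? suc M * base s
    ... | yes _ = base s
    ... | no _  = suc s

    class : ℕ → ℕ
    class zero    = 0
    class (suc s) with M * suc s ≤? suc M * base s
    ... | yes _ = class s
    ... | no _  = suc (class s)

    *≤base : ∀ s → M * s ≤ suc M * base s
    *≤base zero    rewrite *-zeroʳ M = z≤n
    *≤base (suc s) with M * suc s ≤? suc M * base s
    ... | yes p = p
    ... | no _  = *-monoˡ-≤ (suc s) (n≤1+n M)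

    base≤ : ∀ s → .{{NonZero s}} → base s ≤ s
    base≤ (suc s) with M * suc s ≤? suc M * base s
    ... | no _ = ≤-refl
    base≤ (suc zero)    | yes _ = ≤-refl
    base≤ (suc (suc s)) | yes _ = m≤n⇒m≤1+n (base≤ (suc s))

    class-step : ∀ s → class s ≤ class (suc s)
    class-step s with M * suc s ≤? suc M * base s
    ... | yes _ = ≤-refl
    ... | no _  = n≤1+n _

    class-mono-≤′ : ∀ {s t} → s ≤′ t → class s ≤ class t
    class-mono-≤′ ≤′-refl       = ≤-refl
    class-mono-≤′ (≤′-step s≤t) = ≤-trans (class-mono-≤′ s≤t) (class-step _)

    class-mono : ∀ {s t} → s ≤ t → class s ≤ class t
    class-mono = class-mono-≤′ ∘ ≤⇒≤′

    -- The base moves only in steps that raise the class, and the class never comes down again.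
    class⇒base : ∀ {s t} → s ≤′ t → class s ≡ class t → base s ≡ base t
    class⇒base ≤′-refl               e = refl
    class⇒base {t = suc t} (≤′-step s≤t) e with M * suc t ≤? suc M * base t
    ... | yes _ = class⇒base s≤t e
    ... | no _  = contradiction (≤-reflexive (sym e)) (<⇒≱ (s≤s (class-mono-≤′ s≤t)))

    -- Both sizes are rounded down to the same base, which `t` exceeds by at most the factor (M + 1)
    -- / M and which is at most `s`.
    sameClass : ∀ {s t} → .{{NonZero s}} → s ≤ t → class s ≡ class t → M * t ≤ suc M * s
    sameClass {s} {t} s≤t e = begin
      M * t          ≤⟨ *≤base t ⟩
      suc M * base t ≡⟨ cong (suc M *_) (class⇒base (≤⇒≤′ s≤t) e) ⟨
      suc M * base s ≤⟨ *-monoʳ-≤ (suc M) (base≤ s) ⟩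
      suc M * s      ∎
      where open ≤-Reasoning

    -- Every rise of the class multiplies the base by more than (M + 1) / M; denominators are
    -- cleared.
    base-growth : ∀ s → suc M ^ class s ≤ M ^ class s * base s
    base-growth zero    = ≤-refl
    base-growth (suc s) with M * suc s ≤? suc M * base s
    ... | yes _ = base-growth s
    ... | no ¬p = begin
      suc M * suc M ^ class s          ≤⟨ *-monoʳ-≤ (suc M) (base-growth s) ⟩
      suc M * (M ^ class s * base s)   ≡⟨ lemma (suc M) (M ^ class s) (base s) ⟩
      M ^ class s * (suc M * base s)   ≤⟨ *-monoʳ-≤ (M ^ class s) (<⇒≤ (≰⇒> ¬p)) ⟩
      M ^ class s * (M * suc s)        ≡⟨ lemma′ (M ^ class s) M (suc s) ⟩
      M * M ^ class s * suc s          ∎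
      where
      open ≤-Reasoning
      lemma : ∀ x y z → x * (y * z) ≡ y * (x * z)
      lemma = solve-∀
      lemma′ : ∀ x y z → x * (y * z) ≡ y * x * z
      lemma′ = solve-∀

  ∈-children⁺ : ∀ {y} {Y : Set y} {m} (f : Fin (suc m) → List Y) i {x} → x ∈ f i → x ∈ concatMap f (allFin (suc m))
  ∈-children⁺ {m = m} f i {x} x∈ = ∈-concatMap⁺ f (lose (∈-allFin i) x∈)

  ∈-children⁻ : ∀ {y} {Y : Set y} {m} (f : Fin (suc m) → List Y) {x} → x ∈ concatMap f (allFin (suc m)) → ∃ λ i → x ∈ f i
  ∈-children⁻ {m = m} f x∈ with find (∈-concatMap⁻ f {xs = allFin (suc m)} x∈)
  ... | i , _ , x∈i = i , x∈i

  ∑-child≤ : ∀ {y} {Y : Set y} {m} (f : Fin (suc m) → List Y) i g → ∑ℕ (f i) g ≤ ∑ℕ (concatMap f (allFin (suc m))) g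
  ∑-child≤ {m = m} f i g = ≤-trans
    (∑ℕ.term≤∑ {f = λ i → ∑ℕ (f i) g} (λ _ → z≤n) (∈-allFin i))
    (≤-reflexive (sym (∑ℕ.∑-concatMap f (allFin (suc m)) g)))

  -- An internal node `branch Γ m ts` has m + 1 children.
  data Hierarchy (L : Set α) (n : ℕ) : Set α where
    leaf   : Fin n → Hierarchy L n
    branch : L → (m : ℕ) → (Fin (suc m) → Hierarchy L n) → Hierarchy L n

  module _ {L : Set α} {n : ℕ} where
    points : Hierarchy L n → List (Fin n)
    points (leaf x)        = x ∷ []
    points (branch _ m ts) = concatMap (λ i → points (ts i)) (allFin (suc m))

    #points : Hierarchy L n → ℕ
    #points t = length (points t)

    size≢0 : ∀ t → NonZero (#points t)
    size≢0 (leaf x)        = _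
    size≢0 (branch _ m ts) with points (ts Fin.zero) | size≢0 (ts Fin.zero)
    ... | _ ∷ _ | _ = _

    -- Uniform if r is uniform below a multiple of #points t.
    sample : Hierarchy L n → ℕ → Fin n
    sample t r = lookup (points t) (r mod #points t)
      where instance _ = size≢0 t

    module _ (B : Fin n → Bool) where
      count : Hierarchy L n → ℕ
      count t = ∑ℕ (points t) (λ x → ⟦ B x ⟧)

      -- Each position in `points t` is hit by exactly `q` of the residues.
      sample-count : ∀ t q → ∑ℕ (upTo (q * #points t)) (λ r → ⟦ B (sample t r) ⟧) ≡ q * count t
      sample-count t q = trans
        (periodic-∑ q (#points t) f λ r → cong (λ i → ⟦ B (lookup (points t) i) ⟧) (Fin.toℕ-injective
          (trans (toℕ-mod (#points t + r)) (trans (trans (cong (_% #points t) (+-comm (#points t) r)) ([m+n]%n≡m%n r (#points t))) (sym (toℕ-mod r))))))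
        (cong (q *_) (applyUpTo-∑-lookup id f (points t) _ λ i → cong (λ i → ⟦ B (lookup (points t) i) ⟧) (Fin.toℕ-injective
          (trans (toℕ-mod (toℕ i)) (m<n⇒m%n≡m (Fin.toℕ<n i))))))
        where
        instance _ = size≢0 t
        f : ℕ → ℕ
        f r = ⟦ B (sample t r) ⟧
        toℕ-mod : ∀ r → toℕ (r mod #points t) ≡ r % #points t
        toℕ-mod r = Fin.toℕ-fromℕ< (m%n<n r (#points t))

    module Anchors (M : ℕ) where
      open Classes M

      sizeClass : Hierarchy L n → ℕ
      sizeClass t = class (#points t)

      sameClassChild? : ∀ Γ m ts → Dec (∃ λ i → sizeClass (ts i) ≡ sizeClass (branch Γ m ts))
      sameClassChild? Γ m ts = Fin.any? λ i → sizeClass (ts i) ≟ sizeClass (branch Γ m ts)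

      -- The descent goes to the lowest node of the class because samples taken there belong to
      -- every node on the way, so that one net can serve all of them.
      anchor : Hierarchy L n → Hierarchy L n
      anchor (leaf x) = leaf x
      anchor (branch Γ m ts) with sameClassChild? Γ m ts
      ... | yes (i , _) = anchor (ts i)
      ... | no _        = branch Γ m ts

      -- These are the nodes of `t` that are their own anchor: the leaves, and the branches none of
      -- whose children has the same class.
      anchors : Hierarchy L n → List (Hierarchy L n)
      anchors (leaf x) = leaf x ∷ []
      anchors (branch Γ m ts) with sameClassChild? Γ m ts
      ... | yes _ = concatMap (λ i → anchors (ts i)) (allFin (suc m))
      ... | no _  = branch Γ m ts ∷ concatMap (λ i → anchors (ts i)) (allFin (suc m))

      anchor∈anchors : ∀ t → anchor t ∈ anchors t
      anchor∈anchors (leaf x) = here refl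
      anchor∈anchors (branch Γ m ts) with sameClassChild? Γ m ts
      ... | yes (i , _) = ∈-children⁺ (λ i → anchors (ts i)) i (anchor∈anchors (ts i))
      ... | no _        = here refl

      ∑-anchor≤ : ∀ t g → ∑ℕ (points (anchor t)) g ≤ ∑ℕ (points t) g
      ∑-anchor≤ (leaf x) g = ≤-refl
      ∑-anchor≤ (branch Γ m ts) g with sameClassChild? Γ m ts
      ... | yes (i , _) = ≤-trans (∑-anchor≤ (ts i) g) (∑-child≤ (λ i → points (ts i)) i g)
      ... | no _        = ≤-refl

      points-anchor⊆ : ∀ t {x} → x ∈ points (anchor t) → x ∈ points t
      points-anchor⊆ (leaf x) p = p
      points-anchor⊆ (branch Γ m ts) p with sameClassChild? Γ m ts
      ... | yes (i , _) = ∈-children⁺ (λ i → points (ts i)) i (points-anchor⊆ (ts i) p)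
      ... | no _        = p

      size-child≤ : ∀ Γ m ts i → #points (ts i) ≤ #points (branch Γ m ts)
      size-child≤ Γ m ts i = begin
        #points (ts i)                          ≡⟨ ∑-1 (points (ts i)) ⟨
        ∑ℕ (points (ts i)) (λ _ → 1)         ≤⟨ ∑-child≤ (λ i → points (ts i)) i (λ _ → 1) ⟩
        ∑ℕ (points (branch Γ m ts)) (λ _ → 1) ≡⟨ ∑-1 (points (branch Γ m ts)) ⟩
        #points (branch Γ m ts)                 ∎
        where open ≤-Reasoning

      size-anchor≤ : ∀ t → #points (anchor t) ≤ #points t
      size-anchor≤ t = begin
        #points (anchor t)                  ≡⟨ ∑-1 (points (anchor t)) ⟨
        ∑ℕ (points (anchor t)) (λ _ → 1) ≤⟨ ∑-anchor≤ t (λ _ → 1) ⟩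
        ∑ℕ (points t) (λ _ → 1)          ≡⟨ ∑-1 (points t) ⟩
        #points t                           ∎
        where open ≤-Reasoning

      sizeClass-anchor : ∀ t → sizeClass (anchor t) ≡ sizeClass t
      sizeClass-anchor (leaf x) = refl
      sizeClass-anchor (branch Γ m ts) with sameClassChild? Γ m ts
      ... | yes (i , e) = trans (sizeClass-anchor (ts i)) e
      ... | no _        = refl

      size≤anchor : ∀ t → M * #points t ≤ suc M * #points (anchor t)
      size≤anchor t = sameClass {{size≢0 (anchor t)}} (size-anchor≤ t) (sizeClass-anchor t)

      anchors-size≤ : ∀ t {w} → w ∈ anchors t → #points w ≤ #points t
      anchors-size≤ (leaf x) (here refl) = ≤-refl
      anchors-size≤ (branch Γ m ts) p with sameClassChild? Γ m ts
      anchors-size≤ (branch Γ m ts) p           | yes _ with ∈-children⁻ (λ i → anchors (ts i)) p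
      ... | i , q = ≤-trans (anchors-size≤ (ts i) q) (size-child≤ Γ m ts i)
      anchors-size≤ (branch Γ m ts) (here refl) | no _ = ≤-refl
      anchors-size≤ (branch Γ m ts) (there p)   | no _ with ∈-children⁻ (λ i → anchors (ts i)) p
      ... | i , q = ≤-trans (anchors-size≤ (ts i) q) (size-child≤ Γ m ts i)

      -- The class drops strictly from an anchor to each of its children, so the anchors above one
      -- leaf have distinct classes, all at most `sizeClass t`.
      anchors-count≤ : ∀ B t → ∑ℕ (anchors t) (count B) ≤ suc (sizeClass t) * count B t
      anchors-count≤ B (leaf x) = +-mono-≤ {count B (leaf x)} {count B (leaf x)} ≤-refl z≤n
      anchors-count≤ B (branch Γ m ts) with sameClassChild? Γ m ts
      ... | yes _ = begin
        ∑ℕ (concatMap (λ i → anchors (ts i)) (allFin (suc m))) (count B)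
          ≡⟨ ∑ℕ.∑-concatMap (λ i → anchors (ts i)) (allFin (suc m)) (count B) ⟩
        ∑ℕ (allFin (suc m)) (λ i → ∑ℕ (anchors (ts i)) (count B))
          ≤⟨ ∑ℕ.∑-mono (allFin (suc m)) (λ {i} _ → ≤-trans (anchors-count≤ B (ts i))
               (*-monoˡ-≤ (count B (ts i)) (s≤s (class-mono (size-child≤ Γ m ts i))))) ⟩
        ∑ℕ (allFin (suc m)) (λ i → suc (sizeClass t) * count B (ts i))
          ≡⟨ ∑ℕ.∑-*ˡ (suc (sizeClass t)) (allFin (suc m)) (λ i → count B (ts i)) ⟨
        suc (sizeClass t) * ∑ℕ (allFin (suc m)) (λ i → count B (ts i))
          ≡⟨ cong (suc (sizeClass t) *_) (∑ℕ.∑-concatMap (λ i → points (ts i)) (allFin (suc m)) _) ⟨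
        suc (sizeClass t) * count B t ∎
        where
        open ≤-Reasoning
        t = branch Γ m ts
      ... | no ¬same = begin
        count B t + ∑ℕ (concatMap (λ i → anchors (ts i)) (allFin (suc m))) (count B)
          ≡⟨ cong (count B t +_) (∑ℕ.∑-concatMap (λ i → anchors (ts i)) (allFin (suc m)) (count B)) ⟩
        count B t + ∑ℕ (allFin (suc m)) (λ i → ∑ℕ (anchors (ts i)) (count B))
          ≤⟨ +-monoʳ-≤ (count B t) (∑ℕ.∑-mono (allFin (suc m)) (λ {i} _ → ≤-trans (anchors-count≤ B (ts i))
               (*-monoˡ-≤ (count B (ts i)) (≤∧≢⇒< (class-mono (size-child≤ Γ m ts i)) λ e → ¬same (i , e))))) ⟩
        count B t + ∑ℕ (allFin (suc m)) (λ i → sizeClass t * count B (ts i))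
          ≡⟨ cong (count B t +_) (∑ℕ.∑-*ˡ (sizeClass t) (allFin (suc m)) (λ i → count B (ts i))) ⟨
        count B t + sizeClass t * ∑ℕ (allFin (suc m)) (λ i → count B (ts i))
          ≡⟨ cong (λ z → count B t + sizeClass t * z) (∑ℕ.∑-concatMap (λ i → points (ts i)) (allFin (suc m)) _) ⟨
        count B t + sizeClass t * count B t ∎
        where
        open ≤-Reasoning
        t = branch Γ m ts

  ^-distribʳ-* : ∀ k x y → (x * y) ^ k ≡ x ^ k * y ^ k
  ^-distribʳ-* zero    x y = refl
  ^-distribʳ-* (suc k) x y = trans (cong (x * y *_) (^-distribʳ-* k x y)) (lemma x y (x ^ k) (y ^ k))
    where
    lemma : ∀ x y u v → x * y * (u * v) ≡ x * u * (y * v)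
    lemma = solve-∀

  -- Expected number of points below dead nodes.

  module Covering {L : Set α} {n : ℕ} (p : ℕ) (B : Fin n → Bool) where
    open Anchors {L = L} {n = n} (suc p)

    allInB : List ℕ → Hierarchy L n → Bool
    allInB ω t = all (λ r → B (sample t r)) ω

    dead : List ℕ → Hierarchy L n → Bool
    dead ω t = allInB ω (anchor t)

    -- The descent stops at the topmost dead nodes. Their subtrees do not overlap, so each anchor is
    -- charged for at most one of them.
    covered : List ℕ → Hierarchy L n → List (Fin n)
    covered ω (leaf x)          = if dead ω (leaf x) then x ∷ [] else []
    covered ω t@(branch Γ m ts) =
      if dead ω t then points t else concatMap (λ i → covered ω (ts i)) (allFin (suc m))

    -- An anchor with almost all of its points in B is paid for by B itself; any
    -- other pays, when it dies, for the largest t that it can be the anchor of.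
    cost : List ℕ → Hierarchy L n → ℕ
    cost ω w with p * #points w ≤? suc p * count B w
    ... | yes _ = 0
    ... | no _  = ⟦ allInB ω w ⟧ * (2 * p * #points w)

    -- If the anchor is full, the ratios (p+2)/(p+1) and (p+1)/p multiply to (p+2)/p. Otherwise
    -- `cost` is in force, whose factor 2 is a crude bound on (p+2)/(p+1).
    dead⇒size≤ : ∀ ω t → dead ω t ≡ true →
      p * #points t ≤ (2 + p) * count B t + ∑ℕ (anchors t) (cost ω)
    dead⇒size≤ ω t isDead = ≤-trans size≤cost (+-monoʳ-≤ ((2 + p) * count B t)
      (∑ℕ.term≤∑ {f = cost ω} (λ _ → z≤n) (anchor∈anchors t)))
      where
      open ≤-Reasoning
      w = anchor t
      lemma : ∀ x y z → x * (y * z) ≡ y * (x * z)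
      lemma = solve-∀
      lemma₂ : ∀ p s → (2 + p) * s + p * s ≡ suc p * (2 * s)
      lemma₂ = solve-∀
      size≤cost : p * #points t ≤ (2 + p) * count B t + cost ω w
      size≤cost with p * #points w ≤? suc p * count B w
      ... | yes full = ≤-trans (*-cancelˡ-≤ (suc p) (begin
        suc p * (p * #points t)               ≡⟨ lemma (suc p) p (#points t) ⟩
        p * (suc p * #points t)               ≤⟨ *-monoʳ-≤ p (size≤anchor t) ⟩
        p * ((2 + p) * #points w)             ≡⟨ lemma p (2 + p) (#points w) ⟩
        (2 + p) * (p * #points w)             ≤⟨ *-monoʳ-≤ (2 + p) full ⟩
        (2 + p) * (suc p * count B w)      ≤⟨ *-monoʳ-≤ (2 + p) (*-monoʳ-≤ (suc p) (∑-anchor≤ t _)) ⟩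
        (2 + p) * (suc p * count B t)      ≡⟨ lemma (2 + p) (suc p) (count B t) ⟩
        suc p * ((2 + p) * count B t)      ∎)) (m≤m+n _ 0)
      ... | no _ rewrite isDead = begin
        p * #points t                            ≤⟨ *-monoʳ-≤ p (*-cancelˡ-≤ (suc p) (begin
          suc p * #points t                        ≤⟨ size≤anchor t ⟩
          (2 + p) * #points w                      ≤⟨ m≤m+n _ (p * #points w) ⟩
          (2 + p) * #points w + p * #points w         ≡⟨ lemma₂ p (#points w) ⟩
          suc p * (2 * #points w)                  ∎)) ⟩
        p * (2 * #points w)                      ≡⟨ lemma p 2 (#points w) ⟩
        2 * (p * #points w)                      ≡⟨ *-assoc 2 p (#points w) ⟨
        2 * p * #points w                        ≡⟨ +-identityʳ _ ⟨
        1 * (2 * p * #points w)                  ≤⟨ m≤n+m _ ((2 + p) * count B t) ⟩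
        (2 + p) * count B t + 1 * (2 * p * #points w) ∎

    ∑-children≤∑-anchors : ∀ Γ m ts g →
      ∑ℕ (concatMap (λ i → anchors (ts i)) (allFin (suc m))) g ≤ ∑ℕ (anchors (branch Γ m ts)) g
    ∑-children≤∑-anchors Γ m ts g with sameClassChild? Γ m ts
    ... | yes _ = ≤-refl
    ... | no _  = m≤n+m _ (g (branch Γ m ts))

    covered-length≤ : ∀ ω t →
      p * length (covered ω t) ≤ (2 + p) * count B t + ∑ℕ (anchors t) (cost ω)
    covered-length≤ ω (leaf x) with dead ω (leaf x) in isDead
    ... | true  = dead⇒size≤ ω (leaf x) isDead
    ... | false rewrite *-zeroʳ p = z≤n
    covered-length≤ ω t@(branch Γ m ts) with dead ω t in isDead
    ... | true  = dead⇒size≤ ω t isDead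
    ... | false = begin
      p * length (concatMap (λ i → covered ω (ts i)) children)
        ≡⟨ cong (p *_) (length-concatMap (λ i → covered ω (ts i)) children) ⟩
      p * ∑ℕ children (λ i → length (covered ω (ts i)))
        ≡⟨ ∑ℕ.∑-*ˡ p children _ ⟩
      ∑ℕ children (λ i → p * length (covered ω (ts i)))
        ≤⟨ ∑ℕ.∑-mono children (λ {i} _ → covered-length≤ ω (ts i)) ⟩
      ∑ℕ children (λ i → (2 + p) * count B (ts i) + ∑ℕ (anchors (ts i)) (cost ω))
        ≡⟨ ∑ℕ.∑-+ children (λ i → (2 + p) * count B (ts i)) _ ⟩
      ∑ℕ children (λ i → (2 + p) * count B (ts i)) + ∑ℕ children (λ i → ∑ℕ (anchors (ts i)) (cost ω))
        ≡⟨ cong₂ _+_ (∑ℕ.∑-*ˡ (2 + p) children (λ i → count B (ts i))) (∑ℕ.∑-concatMap (λ i → anchors (ts i)) children (cost ω)) ⟨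
      (2 + p) * ∑ℕ children (λ i → count B (ts i)) + ∑ℕ (concatMap (λ i → anchors (ts i)) children) (cost ω)
        ≡⟨ cong (λ z → (2 + p) * z + ∑ℕ (concatMap (λ i → anchors (ts i)) children) (cost ω)) (∑ℕ.∑-concatMap (λ i → points (ts i)) children _) ⟨
      (2 + p) * count B t + ∑ℕ (concatMap (λ i → anchors (ts i)) children) (cost ω)
        ≤⟨ +-monoʳ-≤ ((2 + p) * count B t) (∑-children≤∑-anchors Γ m ts (cost ω)) ⟩
      (2 + p) * count B t + ∑ℕ (anchors t) (cost ω) ∎
      where
      open ≤-Reasoning
      children = allFin (suc m)

    module _ {{_ : NonZero p}} (N l D : ℕ) {{_ : NonZero D}}
             (enough : 2 * p * D * p ^ l ≤ suc p ^ l) where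

      Ω : List (List ℕ)
      Ω = sequences N (suc l)

      -- An anchor that is not full dies with probability (c/s) ^ (l+1), where c/s is below p/(p+1).
      -- By `enough`, `l` of the draws contribute at most 1/(2pD), which cancels the coefficient 2p
      -- of `cost` and leaves 1/D. The one remaining factor c/s turns the size s of the anchor into
      -- its number c of points in B, so that B can be charged point by point.
      ∑-cost≤ : ∀ w → #points w ∣ N → D * ∑ℕ Ω (λ ω → cost ω w) ≤ N ^ suc l * count B w
      ∑-cost≤ w (divides q N≡q*s) with p * #points w ≤? suc p * count B w
      ... | yes _ rewrite ∑ℕ.∑-zero Ω | *-zeroʳ D = z≤n
      ... | no ¬full = begin
        D * ∑ℕ Ω (λ ω → ⟦ allInB ω w ⟧ * (2 * p * s))
          ≡⟨ cong (D *_) (∑ℕ.∑-*ʳ (2 * p * s) Ω _) ⟨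
        D * (∑ℕ Ω (λ ω → ⟦ allInB ω w ⟧) * (2 * p * s))
          ≡⟨ cong (λ z → D * (z * (2 * p * s))) (trans (∑-sequences N (suc l) _)
               (cong (_^ suc l) (trans (cong (λ N → ∑ℕ (upTo N) _) N≡q*s) (sample-count B w q)))) ⟩
        D * (q * c * (q * c) ^ l * (2 * p * s))
          ≡⟨ rearrange D q c ((q * c) ^ l) p s ⟩
        q * s * c * (2 * p * D * (q * c) ^ l)
          ≤⟨ *-monoʳ-≤ (q * s * c) (*-cancelˡ-≤ (p ^ l) {{m^n≢0 p l}} (begin
            p ^ l * (2 * p * D * (q * c) ^ l)  ≡⟨ rearrange₂ (p ^ l) (2 * p * D) ((q * c) ^ l) ⟩
            2 * p * D * p ^ l * (q * c) ^ l    ≤⟨ *-monoˡ-≤ ((q * c) ^ l) enough ⟩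
            suc p ^ l * (q * c) ^ l            ≡⟨ ^-distribʳ-* l (suc p) (q * c) ⟨
            (suc p * (q * c)) ^ l              ≤⟨ ^-monoˡ-≤ l (begin
              suc p * (q * c)                    ≡⟨ rearrange₃ (suc p) q c ⟩
              q * (suc p * c)                    ≤⟨ *-monoʳ-≤ q (<⇒≤ (≰⇒> ¬full)) ⟩
              q * (p * s)                        ≡⟨ rearrange₃ q p s ⟩
              p * (q * s)                        ∎) ⟩
            (p * (q * s)) ^ l                  ≡⟨ ^-distribʳ-* l p (q * s) ⟩
            p ^ l * (q * s) ^ l                ∎)) ⟩
        q * s * c * (q * s) ^ l
          ≡⟨ rearrange₄ (q * s) c ((q * s) ^ l) ⟩
        q * s * (q * s) ^ l * c
          ≡⟨ cong (λ N → N ^ suc l * c) N≡q*s ⟨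
        N ^ suc l * c ∎
        where
        open ≤-Reasoning
        s = #points w
        c = count B w
        rearrange : ∀ D q c X p s → D * (q * c * X * (2 * p * s)) ≡ q * s * c * (2 * p * D * X)
        rearrange = solve-∀
        rearrange₂ : ∀ x y z → x * (y * z) ≡ y * x * z
        rearrange₂ = solve-∀
        rearrange₃ : ∀ x y z → x * (y * z) ≡ y * (x * z)
        rearrange₃ = solve-∀
        rearrange₄ : ∀ x y z → x * y * z ≡ x * z * y
        rearrange₄ = solve-∀

      -- Of `3 + p`, the part `2 + p` comes from dead nodes with full anchors. The last unit pays
      -- for the other anchors: each costs on average at most a share 1/D of its points in B, and a
      -- point lies below at most D anchors.
      ∑-covered≤ : ∀ t → (∀ {s} → s ≤ #points t → .{{NonZero s}} → s ∣ N) → suc (sizeClass t) ≤ D →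
        p * ∑ℕ Ω (λ ω → length (covered ω t)) ≤ N ^ suc l * ((3 + p) * count B t)
      ∑-covered≤ t s∣N class<D = begin
        p * ∑ℕ Ω (λ ω → length (covered ω t))
          ≡⟨ ∑ℕ.∑-*ˡ p Ω _ ⟩
        ∑ℕ Ω (λ ω → p * length (covered ω t))
          ≤⟨ ∑ℕ.∑-mono Ω (λ {ω} _ → covered-length≤ ω t) ⟩
        ∑ℕ Ω (λ ω → (2 + p) * b + ∑ℕ (anchors t) (cost ω))
          ≡⟨ ∑ℕ.∑-+ Ω (λ _ → (2 + p) * b) _ ⟩
        ∑ℕ Ω (λ ω → (2 + p) * b) + ∑ℕ Ω (λ ω → ∑ℕ (anchors t) (cost ω))
          ≡⟨ cong₂ _+_ constant (∑ℕ.∑-swap Ω (anchors t) cost) ⟩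
        N ^ suc l * ((2 + p) * b) + ∑ℕ (anchors t) (λ w → ∑ℕ Ω (λ ω → cost ω w))
          ≤⟨ +-monoʳ-≤ (N ^ suc l * ((2 + p) * b)) (*-cancelˡ-≤ D (begin
            D * ∑ℕ (anchors t) (λ w → ∑ℕ Ω (λ ω → cost ω w))
              ≡⟨ ∑ℕ.∑-*ˡ D (anchors t) _ ⟩
            ∑ℕ (anchors t) (λ w → D * ∑ℕ Ω (λ ω → cost ω w))
              ≤⟨ ∑ℕ.∑-mono (anchors t) (λ {w} w∈ → ∑-cost≤ w (s∣N (anchors-size≤ t w∈) {{size≢0 w}})) ⟩
            ∑ℕ (anchors t) (λ w → N ^ suc l * count B w)
              ≡⟨ ∑ℕ.∑-*ˡ (N ^ suc l) (anchors t) (count B) ⟨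
            N ^ suc l * ∑ℕ (anchors t) (count B)
              ≤⟨ *-monoʳ-≤ (N ^ suc l) (≤-trans (anchors-count≤ B t) (*-monoˡ-≤ b class<D)) ⟩
            N ^ suc l * (D * b)
              ≡⟨ rearrange (N ^ suc l) D b ⟩
            D * (N ^ suc l * b) ∎)) ⟩
        N ^ suc l * ((2 + p) * b) + N ^ suc l * b
          ≡⟨ rearrange₂ (N ^ suc l) p b ⟩
        N ^ suc l * ((3 + p) * b) ∎
        where
        open ≤-Reasoning
        b = count B t
        rearrange : ∀ x y z → x * (y * z) ≡ y * (x * z)
        rearrange = solve-∀
        rearrange₂ : ∀ X p b → X * ((2 + p) * b) + X * b ≡ X * ((3 + p) * b)
        rearrange₂ = solve-∀
        constant : ∑ℕ Ω (λ ω → (2 + p) * b) ≡ N ^ suc l * ((2 + p) * b)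
        constant = begin-equality
          ∑ℕ Ω (λ ω → (2 + p) * b)                ≡⟨ ∑ℕ.∑-cong Ω (λ _ → sym (+-identityʳ ((2 + p) * b))) ⟩
          ∑ℕ Ω (λ ω → 1 * ((2 + p) * b))          ≡⟨ ∑ℕ.∑-*ʳ ((2 + p) * b) Ω (λ _ → 1) ⟨
          ∑ℕ Ω (λ ω → 1) * ((2 + p) * b)          ≡⟨ cong (_* ((2 + p) * b)) (trans (∑-1 Ω) (length-sequences N (suc l))) ⟩
          N ^ suc l * ((2 + p) * b)               ∎

  -- Integer logarithms and the number of samples.

  ∃-⌊log₂⌋ : ∀ s → .{{NonZero s}} → ∃ λ e → 2 ^ e ≤ s × s < 2 ^ suc e
  ∃-⌊log₂⌋ (suc zero)    = 0 , ≤-refl , ≤-refl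
  ∃-⌊log₂⌋ (suc (suc s)) with ∃-⌊log₂⌋ (suc s)
  ... | e , lower , upper with suc (suc s) <? 2 ^ suc e
  ...   | yes below = e , m≤n⇒m≤1+n lower , below
  ...   | no ¬below = suc e , ≮⇒≥ ¬below , (begin-strict
    suc (suc s)                 ≤⟨ upper ⟩
    2 ^ suc e                   <⟨ m<m+n (2 ^ suc e) (m^n>0 2 (suc e)) ⟩
    2 ^ suc e + 2 ^ suc e       ≡⟨ cong (2 ^ suc e +_) (+-identityʳ _) ⟨
    2 ^ suc (suc e)             ∎)
    where open ≤-Reasoning

  -- The inequality (1 + 1/p) ^ k ≥ 1 + k/p, multiplied by p ^ (k+1).
  bernoulli : ∀ p k → p ^ k * (p + k) ≤ p * suc p ^ k
  bernoulli p zero    = ≤-reflexive (trans (+-identityʳ _) (trans (+-identityʳ p) (sym (*-identityʳ p))))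
  bernoulli p (suc k) = begin
    p * p ^ k * (p + suc k)         ≤⟨ m≤m+n _ (p ^ k * k) ⟩
    p * p ^ k * (p + suc k) + p ^ k * k ≡⟨ lemma p k (p ^ k) ⟩
    suc p * (p ^ k * (p + k))       ≤⟨ *-monoʳ-≤ (suc p) (bernoulli p k) ⟩
    suc p * (p * suc p ^ k)         ≡⟨ lemma₂ (suc p) p (suc p ^ k) ⟩
    p * (suc p * suc p ^ k)         ∎
    where
    open ≤-Reasoning
    lemma : ∀ p k X → p * X * (p + suc k) + X * k ≡ suc p * (X * (p + k))
    lemma = solve-∀
    lemma₂ : ∀ x y z → x * (y * z) ≡ y * (x * z)
    lemma₂ = solve-∀

  2*p^p≤[1+p]^p : ∀ p → .{{NonZero p}} → 2 * p ^ p ≤ suc p ^ p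
  2*p^p≤[1+p]^p p = *-cancelˡ-≤ p (begin
    p * (2 * p ^ p)   ≡⟨ lemma p (p ^ p) ⟩
    p ^ p * (p + p)   ≤⟨ bernoulli p p ⟩
    p * suc p ^ p     ∎)
    where
    open ≤-Reasoning
    lemma : ∀ p X → p * (2 * X) ≡ X * (p + p)
    lemma = solve-∀

  2^a*p^pa≤[1+p]^pa : ∀ p a → .{{NonZero p}} → 2 ^ a * p ^ (p * a) ≤ suc p ^ (p * a)
  2^a*p^pa≤[1+p]^pa p a = begin
    2 ^ a * p ^ (p * a)   ≡⟨ cong (2 ^ a *_) (^-*-assoc p p a) ⟨
    2 ^ a * (p ^ p) ^ a   ≡⟨ ^-distribʳ-* a 2 (p ^ p) ⟨
    (2 * p ^ p) ^ a       ≤⟨ ^-monoˡ-≤ a (2*p^p≤[1+p]^p p) ⟩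
    (suc p ^ p) ^ a       ≡⟨ ^-*-assoc (suc p) p a ⟩
    suc p ^ (p * a)       ∎
    where open ≤-Reasoning

  -- If the class were at least `M * e`, then `base-growth` would give s ≥ (1 + 1/M) ^ (M * e) ≥ 2 ^
  -- e.
  class-bound : ∀ M s e → .{{NonZero M}} → .{{NonZero s}} → s < 2 ^ e → Classes.class M s < M * e
  class-bound M s e s<2^e = ≰⇒> λ Me≤κ → <⇒≱ s<2^e (*-cancelˡ-≤ (M ^ κ) {{m^n≢0 M κ}} (begin
    M ^ κ * 2 ^ e                                  ≡⟨ cong (λ k → M ^ k * 2 ^ e) (m+[n∸m]≡n Me≤κ) ⟨
    M ^ (M * e + r Me≤κ) * 2 ^ e                   ≡⟨ cong (_* 2 ^ e) (^-distribˡ-+-* M (M * e) _) ⟩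
    M ^ (M * e) * M ^ r Me≤κ * 2 ^ e               ≡⟨ lemma (M ^ (M * e)) (M ^ r Me≤κ) (2 ^ e) ⟩
    2 ^ e * M ^ (M * e) * M ^ r Me≤κ               ≤⟨ *-mono-≤ (2^a*p^pa≤[1+p]^pa M e) (^-monoˡ-≤ (r Me≤κ) (n≤1+n M)) ⟩
    suc M ^ (M * e) * suc M ^ r Me≤κ               ≡⟨ ^-distribˡ-+-* (suc M) (M * e) _ ⟨
    suc M ^ (M * e + r Me≤κ)                       ≡⟨ cong (suc M ^_) (m+[n∸m]≡n Me≤κ) ⟩
    suc M ^ κ                                      ≤⟨ base-growth s ⟩
    M ^ κ * base s                                 ≤⟨ *-monoʳ-≤ (M ^ κ) (base≤ s) ⟩
    M ^ κ * s                                      ∎))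
    where
    open ≤-Reasoning
    open Classes M
    κ = class s
    r : M * e ≤ κ → ℕ
    r _ = κ ∸ M * e
    lemma : ∀ x y z → x * y * z ≡ z * x * y
    lemma = solve-∀

  -- Since (1 + 1/p) ^ p ≥ 2, the probability (p/(p+1)) ^ l is at most 2 ^ -(a+1).
  record SampleCount (p n : ℕ) : Set where
    field
      a e          : ℕ
    D = suc p * suc e
    l = p * suc a
    field
      2^e≤         : 2 ^ e ≤ n
      2^a≤         : 2 ^ a ≤ 2 * p * D
      class<D      : ∀ {s} → s ≤ n → .{{NonZero s}} → Classes.class (suc p) s < D
      enough       : 2 * p * D * p ^ l ≤ suc p ^ l

  -- Both logarithms are rounded down, hence the successors in `D` and `l`: the powers of 2 that
  -- exceed `n` and `2 * p * D` have exponents `suc e` and `suc a`.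
  sampleCount : ∀ p n → .{{NonZero p}} → .{{NonZero n}} → SampleCount p n
  sampleCount p n with ∃-⌊log₂⌋ n
  ... | e , 2^e≤n , n<2^e+1 with ∃-⌊log₂⌋ (2 * p * (suc p * suc e)) {{m*n≢0 (2 * p) (suc p * suc e) {{m*n≢0 2 p}}}}
  ...   | a , 2^a≤K , K<2^a+1 = record
    { a       = a
    ; e       = e
    ; 2^e≤    = 2^e≤n
    ; 2^a≤    = 2^a≤K
    ; class<D = λ {s} s≤n → class-bound (suc p) s (suc e) (≤-<-trans s≤n n<2^e+1)
    ; enough  = ≤-trans (*-monoˡ-≤ (p ^ (p * suc a)) (<⇒≤ K<2^a+1)) (2^a*p^pa≤[1+p]^pa p (suc a))
    }

open Sampling

-- Ordered-field arithmetic, numerals and logarithms from the axioms.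

module RealProperties {c ℓ₁ ℓ₂} (ℝ : RealNumbers c ℓ₁ ℓ₂) where
  open RealNumbers ℝ hiding (zero)
  open IsDecTotalOrder isDecTotalOrder public
    using (_≟_; isPartialOrder; total; antisym)
    renaming (refl to ≤-refl; reflexive to ≤-reflexive; trans to ≤-trans)
  open Algebra.Properties.Ring ring using (-‿distribˡ-*; -‿involutive)
  open Algebra.Properties.Semiring.Mult semiring using (×-homo-+; ×1-homo-*)
  module Solver = Algebra.Solver.Ring.NaturalCoefficients.Default commutativeSemiring
  open Solver public using (solve; _:+_; _:*_; _:=_; con; Polynomial)

  poset : Poset c ℓ₁ ℓ₂
  poset = record { isPartialOrder = isPartialOrder }

  module ≤-Reasoning = Relation.Binary.Reasoning.PartialOrder poset
  open ≤-Reasoning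

  +-monoʳ-≤ : ∀ z {x y} → x ≤ y → z + x ≤ z + y
  +-monoʳ-≤ z {x} {y} x≤y = begin
    z + x ≈⟨ +-comm z x ⟩
    x + z ≤⟨ +-monoˡ-≤ x y z x≤y ⟩
    y + z ≈⟨ +-comm y z ⟩
    z + y ∎

  +-mono-≤ : ∀ {x y u v} → x ≤ y → u ≤ v → x + u ≤ y + v
  +-mono-≤ {x} {y} {u} x≤y u≤v = ≤-trans (+-monoˡ-≤ x y u x≤y) (+-monoʳ-≤ y u≤v)

  x≤x+y : ∀ {x y} → 0# ≤ y → x ≤ x + y
  x≤x+y {x} 0≤y = ≤-trans (≤-reflexive (sym (+-identityʳ x))) (+-monoʳ-≤ x 0≤y)

  +-nonNegative : ∀ {x y} → 0# ≤ x → 0# ≤ y → 0# ≤ x + y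
  +-nonNegative 0≤x 0≤y = ≤-trans 0≤x (x≤x+y 0≤y)

  x-y+y≈x : ∀ x y → x - y + y ≈ x
  x-y+y≈x x y = trans (+-assoc x (- y) y) (trans (+-congˡ (-‿inverseˡ y)) (+-identityʳ x))

  0≤y-x : ∀ {x y} → x ≤ y → 0# ≤ y - x
  0≤y-x {x} {y} x≤y = begin
    0#    ≈⟨ -‿inverseʳ x ⟨
    x - x ≤⟨ +-monoˡ-≤ x y (- x) x≤y ⟩
    y - x ∎

  +-cancelʳ-≤ : ∀ z {x y} → x + z ≤ y + z → x ≤ y
  +-cancelʳ-≤ z {x} {y} p = begin
    x             ≈⟨ lemma x ⟨
    x + z - z     ≤⟨ +-monoˡ-≤ _ _ (- z) p ⟩
    y + z - z     ≈⟨ lemma y ⟩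
    y             ∎
    where
    lemma : ∀ x → x + z - z ≈ x
    lemma x = trans (+-assoc x z (- z)) (trans (+-congˡ (-‿inverseʳ z)) (+-identityʳ x))

  *-monoʳ-≤ : ∀ {z x y} → 0# ≤ z → x ≤ y → z * x ≤ z * y
  *-monoʳ-≤ {z} {x} {y} 0≤z x≤y = begin
    z * x                 ≈⟨ +-identityˡ _ ⟨
    0# + z * x            ≤⟨ +-monoˡ-≤ _ _ (z * x) (*-nonNegative z (y - x) 0≤z (0≤y-x x≤y)) ⟩
    z * (y - x) + z * x   ≈⟨ distribˡ z (y - x) x ⟨
    z * (y - x + x)       ≈⟨ *-congˡ (x-y+y≈x y x) ⟩
    z * y                 ∎

  *-monoˡ-≤ : ∀ {z x y} → 0# ≤ z → x ≤ y → x * z ≤ y * z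
  *-monoˡ-≤ {z} {x} {y} 0≤z x≤y = begin
    x * z ≈⟨ *-comm x z ⟩
    z * x ≤⟨ *-monoʳ-≤ 0≤z x≤y ⟩
    z * y ≈⟨ *-comm z y ⟩
    y * z ∎

  *-mono-≤ : ∀ {x y u v} → 0# ≤ y → 0# ≤ u → x ≤ y → u ≤ v → x * u ≤ y * v
  *-mono-≤ 0≤y 0≤u x≤y u≤v = ≤-trans (*-monoˡ-≤ 0≤u x≤y) (*-monoʳ-≤ 0≤y u≤v)

  -1*-1≈1 : - 1# * - 1# ≈ 1#
  -1*-1≈1 = trans (sym (-‿distribˡ-* 1# (- 1#))) (trans (-‿cong (*-identityˡ (- 1#))) (-‿involutive 1#))

  0≤1 : 0# ≤ 1#
  0≤1 with total 0# 1#
  ... | inj₁ 0≤1 = 0≤1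
  ... | inj₂ 1≤0 = ≤-trans (*-nonNegative (- 1#) (- 1#) 0≤-1 0≤-1) (≤-reflexive -1*-1≈1)
    where
    0≤-1 : 0# ≤ - 1#
    0≤-1 = ≤-trans (0≤y-x 1≤0) (≤-reflexive (+-identityˡ (- 1#)))

  <⇒≱ : ∀ {x y} → x < y → ¬ y ≤ x
  <⇒≱ (x≤y , x≉y) y≤x = x≉y (antisym x≤y y≤x)

  <-≤-trans : ∀ {x y z} → x < y → y ≤ z → x < z
  <-≤-trans x<y@(x≤y , _) y≤z = ≤-trans x≤y y≤z , λ x≈z → <⇒≱ x<y (≤-trans y≤z (≤-reflexive (sym x≈z)))

  <⇒≉0 : ∀ {x} → 0# < x → ¬ x ≈ 0#
  <⇒≉0 (_ , 0≉x) x≈0 = 0≉x (sym x≈0)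

  0<1 : 0# < 1#
  0<1 = 0≤1 , λ 0≈1 → 1≉0 (sym 0≈1)

  ⁻¹-inverseˡ : ∀ {x} → 0# < x → x ⁻¹ * x ≈ 1#
  ⁻¹-inverseˡ {x} 0<x = trans (*-comm _ _) (⁻¹-inverseʳ x (<⇒≉0 0<x))

  0≤⁻¹ : ∀ {x} → 0# < x → 0# ≤ x ⁻¹
  0≤⁻¹ {x} 0<x@(0≤x , _) with total 0# (x ⁻¹)
  ... | inj₁ p = p
  ... | inj₂ p = contradiction (begin
    1#       ≈⟨ ⁻¹-inverseʳ x (<⇒≉0 0<x) ⟨
    x * x ⁻¹ ≤⟨ *-monoʳ-≤ 0≤x p ⟩
    x * 0#   ≈⟨ zeroʳ x ⟩
    0#       ∎) (<⇒≱ 0<1)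

  0<⁻¹ : ∀ {x} → 0# < x → 0# < x ⁻¹
  0<⁻¹ {x} 0<x = 0≤⁻¹ 0<x , λ 0≈x⁻¹ → 1≉0 (trans (sym (⁻¹-inverseʳ x (<⇒≉0 0<x))) (trans (*-congˡ (sym 0≈x⁻¹)) (zeroʳ x)))

  *-cancelˡ-≤ : ∀ {z x y} → 0# < z → z * x ≤ z * y → x ≤ y
  *-cancelˡ-≤ {z} {x} {y} 0<z p = begin
    x               ≈⟨ lemma x ⟨
    z ⁻¹ * (z * x)  ≤⟨ *-monoʳ-≤ (0≤⁻¹ 0<z) p ⟩
    z ⁻¹ * (z * y)  ≈⟨ lemma y ⟩
    y               ∎
    where
    lemma : ∀ x → z ⁻¹ * (z * x) ≈ x
    lemma x = trans (sym (*-assoc _ _ _)) (trans (*-congʳ (⁻¹-inverseˡ 0<z)) (*-identityˡ x))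

  *-positive : ∀ {x y} → 0# < x → 0# < y → 0# < x * y
  *-positive {x} {y} 0<x@(0≤x , _) 0<y@(0≤y , _) = *-nonNegative x y 0≤x 0≤y , λ 0≈xy →
    <⇒≱ 0<y (*-cancelˡ-≤ 0<x (≤-reflexive (trans (sym 0≈xy) (sym (zeroʳ x)))))

  fromℕ-+ : ∀ m n → fromℕ (m ℕ.+ n) ≈ fromℕ m + fromℕ n
  fromℕ-+ = ×-homo-+ 1#

  fromℕ-* : ∀ m n → fromℕ (m ℕ.* n) ≈ fromℕ m * fromℕ n
  fromℕ-* = ×1-homo-*

  0≤fromℕ : ∀ m → 0# ≤ fromℕ m
  0≤fromℕ zero    = ≤-refl
  0≤fromℕ (suc m) = +-nonNegative 0≤1 (0≤fromℕ m)

  fromℕ-mono : ∀ {m n} → m ℕ.≤ n → fromℕ m ≤ fromℕ n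
  fromℕ-mono {n = n} z≤n = 0≤fromℕ n
  fromℕ-mono (s≤s m≤n)   = +-monoʳ-≤ 1# (fromℕ-mono m≤n)

  1≤fromℕ : ∀ m → .{{ℕ.NonZero m}} → 1# ≤ fromℕ m
  1≤fromℕ (suc m) = x≤x+y (0≤fromℕ m)

  0<fromℕ : ∀ m → .{{ℕ.NonZero m}} → 0# < fromℕ m
  0<fromℕ m = <-≤-trans 0<1 (1≤fromℕ m)

  ⌈_⌉ : ∀ x → 0# ≤ x → ∃ λ m → x ≤ fromℕ m × fromℕ m ≤ x + 1#
  ⌈ x ⌉ 0≤x = search (proj₁ (archimedean x)) (proj₁ (proj₂ (archimedean x)))
    where
    search : ∀ m → x ≤ fromℕ m → ∃ λ m → x ≤ fromℕ m × fromℕ m ≤ x + 1#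
    search zero    x≤m = zero , x≤m , +-nonNegative 0≤x 0≤1
    search (suc m) x≤1+m with total x (fromℕ m)
    ... | inj₁ x≤m = search m x≤m
    ... | inj₂ m≤x = suc m , x≤1+m , ≤-trans (+-monoʳ-≤ 1# m≤x) (≤-reflexive (+-comm 1# x))

  log₂-mono-≤ : ∀ {x y} → 0# < x → x ≤ y → log₂ x ≤ log₂ y
  log₂-mono-≤ {x} {y} 0<x x≤y with x ≟ y
  ... | yes x≈y = ≤-reflexive (log₂-cong x y 0<x x≈y)
  ... | no x≉y  = proj₁ (log₂-mono-< x y 0<x (x≤y , x≉y))

  log₂-1 : log₂ 1# ≈ 0#
  log₂-1 = antisym
    (+-cancelʳ-≤ (log₂ 1#) (≤-reflexive (trans (sym double) (sym (+-identityˡ _)))))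
    (+-cancelʳ-≤ (log₂ 1#) (≤-reflexive (trans (+-identityˡ _) double)))
    where
    double : log₂ 1# ≈ log₂ 1# + log₂ 1#
    double = trans (log₂-cong 1# (1# * 1#) 0<1 (sym (*-identityˡ 1#))) (log₂-* 1# 1# 0<1 0<1)

  log₂-2^ : ∀ a → log₂ (fromℕ (2 ℕ.^ a)) ≈ fromℕ a
  log₂-2^ zero    = trans (log₂-cong _ 1# (0<fromℕ 1) (+-identityʳ 1#)) log₂-1
  log₂-2^ (suc a) = begin-equality
    log₂ (fromℕ (2 ℕ.* 2 ℕ.^ a))          ≈⟨ log₂-cong _ _ (0<fromℕ (2 ℕ.* 2 ℕ.^ a) {{ℕ.m^n≢0 2 (suc a)}}) (fromℕ-* 2 (2 ℕ.^ a)) ⟩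
    log₂ (fromℕ 2 * fromℕ (2 ℕ.^ a))      ≈⟨ log₂-* _ _ (0<fromℕ 2) (0<fromℕ (2 ℕ.^ a) {{ℕ.m^n≢0 2 a}}) ⟩
    log₂ (fromℕ 2) + log₂ (fromℕ (2 ℕ.^ a)) ≈⟨ +-cong log₂-2 (log₂-2^ a) ⟩
    1# + fromℕ a                          ∎

  -- The polynomial denotes the very sum `1# + (… + 0#)` to which `fromℕ k` unfolds, so that solver
  -- identities apply to numerals written with `fromℕ`.
  nat : ∀ {m} → ℕ → Polynomial m
  nat zero    = con 0
  nat (suc k) = con 1 :+ nat k

-- Bounding the number of samples by Õ(ν⁻¹ log log n).

module Estimates {c ℓ₁ ℓ₂} (ℝ : RealNumbers c ℓ₁ ℓ₂) where
  open RealNumbers ℝ hiding (zero)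
  open Spanners ℝ
  open RealProperties ℝ
  open ≤-Reasoning

  module _ (n : ℕ) where
    private
      n₃ = n ℕ.⊔ 3
      R  = log₂ (fromℕ n₃)
      L  = log₂ R
      3≤n₃ : 3 ℕ.≤ n₃
      3≤n₃ = ℕ.m≤n⊔m n 3

      instance
        n₃≢0 : ℕ.NonZero n₃
        n₃≢0 = ℕ.>-nonZero (ℕ.≤-trans (s≤s z≤n) 3≤n₃)

    pow≤⇒≤log : ∀ {e x} → fromℕ (2 ℕ.^ e) ≤ x → fromℕ e ≤ log₂ x
    pow≤⇒≤log {e} {x} p = begin
      fromℕ e                 ≈⟨ log₂-2^ e ⟨
      log₂ (fromℕ (2 ℕ.^ e))  ≤⟨ log₂-mono-≤ (0<fromℕ (2 ℕ.^ e) {{ℕ.m^n≢0 2 e}}) p ⟩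
      log₂ x                  ∎

    -- From 3² ≥ 2³. The rational bound 3/2 on log₂ 3 is good enough because its square exceeds 2.
    3≤2log : fromℕ 3 ≤ fromℕ 2 * R
    3≤2log = begin
      fromℕ 3                          ≤⟨ pow≤⇒≤log {3} (fromℕ-mono {8} (ℕ.≤-trans (ℕ.n≤1+n 8) (ℕ.*-mono-≤ 3≤n₃ 3≤n₃))) ⟩
      log₂ (fromℕ (n₃ ℕ.* n₃))         ≈⟨ log₂-cong _ _ (0<fromℕ (n₃ ℕ.* n₃) {{ℕ.m*n≢0 n₃ n₃}}) (fromℕ-* n₃ n₃) ⟩
      log₂ (fromℕ n₃ * fromℕ n₃)       ≈⟨ log₂-* _ _ (0<fromℕ n₃) (0<fromℕ n₃) ⟩
      R + R                            ≈⟨ solve 1 (λ R → R :+ R := nat 2 :* R) refl R ⟩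
      fromℕ 2 * R                      ∎

    1≤log : 1# ≤ R
    1≤log = *-cancelˡ-≤ (0<fromℕ 2) (begin
      fromℕ 2 * 1# ≈⟨ *-identityʳ _ ⟩
      fromℕ 2      ≤⟨ fromℕ-mono (ℕ.n≤1+n 2) ⟩
      fromℕ 3      ≤⟨ 3≤2log ⟩
      fromℕ 2 * R  ∎)

    0<log : 0# < R
    0<log = <-≤-trans 0<1 1≤log

    -- Since R ≥ 3/2, R² ≥ 9/4 ≥ 2. Thus log log n stays away from 0, and additive constants can be
    -- absorbed into multiples of it.
    1≤2loglog : 1# ≤ fromℕ 2 * L
    1≤2loglog = begin
      1#           ≈⟨ log₂-2 ⟨
      log₂ (fromℕ 2) ≤⟨ log₂-mono-≤ (0<fromℕ 2) (*-cancelˡ-≤ (0<fromℕ 4) (begin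
        fromℕ 4 * fromℕ 2              ≈⟨ fromℕ-* 4 2 ⟨
        fromℕ 8                        ≤⟨ fromℕ-mono (ℕ.n≤1+n 8) ⟩
        fromℕ 9                        ≈⟨ fromℕ-* 3 3 ⟩
        fromℕ 3 * fromℕ 3              ≤⟨ *-mono-≤ (≤-trans (0≤fromℕ 3) 3≤2log) (0≤fromℕ 3) 3≤2log 3≤2log ⟩
        fromℕ 2 * R * (fromℕ 2 * R)    ≈⟨ solve 1 (λ R → nat 2 :* R :* (nat 2 :* R) := nat 4 :* (R :* R)) refl R ⟩
        fromℕ 4 * (R * R)              ∎)) ⟩
      log₂ (R * R) ≈⟨ log₂-* R R 0<log 0<log ⟩
      L + L        ≈⟨ solve 1 (λ L → L :+ L := nat 2 :* L) refl L ⟩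
      fromℕ 2 * L  ∎

    0<loglog : 0# < L
    0<loglog = 0≤L , λ 0≈L → <⇒≱ 0<1 (≤-trans 1≤2loglog (≤-reflexive (trans (*-congˡ (sym 0≈L)) (zeroʳ _))))
      where
      0≤L : 0# ≤ L
      0≤L = *-cancelˡ-≤ (0<fromℕ 2) (≤-trans (≤-reflexive (zeroʳ _)) (≤-trans 0≤1 1≤2loglog))

    module _ (ν : Carrier) (0<ν : 0# < ν) (ν<1/6 : ν < fromℕ 6 ⁻¹) where
      private
        y = ν ⁻¹
        q = log₂ y
        s = y * L
        g = log₂ s

      0<y : 0# < y
      0<y = 0<⁻¹ 0<ν

      6≤y : fromℕ 6 ≤ y
      6≤y = begin
        fromℕ 6                    ≈⟨ *-identityʳ _ ⟨
        fromℕ 6 * 1#               ≈⟨ *-congˡ (⁻¹-inverseʳ ν (<⇒≉0 0<ν)) ⟨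
        fromℕ 6 * (ν * y)          ≤⟨ *-monoʳ-≤ (0≤fromℕ 6) (*-monoˡ-≤ (proj₁ 0<y) (proj₁ ν<1/6)) ⟩
        fromℕ 6 * (fromℕ 6 ⁻¹ * y) ≈⟨ *-assoc _ _ _ ⟨
        fromℕ 6 * fromℕ 6 ⁻¹ * y   ≈⟨ *-congʳ (⁻¹-inverseʳ _ (<⇒≉0 (0<fromℕ 6))) ⟩
        1# * y                     ≈⟨ *-identityˡ y ⟩
        y                          ∎

      1≤y : 1# ≤ y
      1≤y = ≤-trans (1≤fromℕ 6) 6≤y

      -- As 2L ≥ 1, passing from y to s = yL lowers the logarithm by at most 1; so log s can stand
      -- in for log (1/ν).
      q≤g+1 : q ≤ g + 1#
      q≤g+1 = begin
        q                                ≈⟨ +-identityʳ q ⟨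
        q + 0#                           ≈⟨ +-congˡ log₂-1 ⟨
        q + log₂ 1#                      ≤⟨ +-monoʳ-≤ q (log₂-mono-≤ 0<1 1≤2loglog) ⟩
        q + log₂ (fromℕ 2 * L)           ≈⟨ +-congˡ (log₂-* _ _ (0<fromℕ 2) 0<loglog) ⟩
        q + (log₂ (fromℕ 2) + log₂ L)    ≈⟨ +-congˡ (+-congʳ log₂-2) ⟩
        q + (1# + log₂ L)                ≈⟨ solve 2 (λ q l → q :+ (con 1 :+ l) := q :+ l :+ con 1) refl q (log₂ L) ⟩
        q + log₂ L + 1#                  ≈⟨ +-congʳ (log₂-* y L 0<y 0<loglog) ⟨
        g + 1#                           ∎

      -- As y ≥ 6 ≥ 4, the logarithm of y is at least 2, and at most 1 of it is lost.
      1≤g : 1# ≤ g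
      1≤g = +-cancelʳ-≤ 1# (begin
        1# + 1#      ≈⟨ +-congˡ (+-identityʳ 1#) ⟨
        fromℕ 2      ≤⟨ pow≤⇒≤log {2} (≤-trans (fromℕ-mono (ℕ.m≤m+n 4 2)) 6≤y) ⟩
        q            ≤⟨ q≤g+1 ⟩
        g + 1#       ∎)

      q≤2g : q ≤ fromℕ 2 * g
      q≤2g = begin
        q            ≤⟨ q≤g+1 ⟩
        g + 1#       ≤⟨ +-monoʳ-≤ g 1≤g ⟩
        g + g        ≈⟨ solve 1 (λ g → g :+ g := nat 2 :* g) refl g ⟩
        fromℕ 2 * g  ∎

      -- By 1 ≤ g and q ≤ 2g the first two terms are at most 12g, hence at most 24Lg as 1 ≤ 2L; the
      -- last is at most Lg.
      exponent≤ : fromℕ 8 + fromℕ 2 * q + L ≤ fromℕ 25 * (L * g)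
      exponent≤ = begin
        fromℕ 8 + fromℕ 2 * q + L
          ≤⟨ +-mono-≤ (+-mono-≤ 8≤8g (*-monoʳ-≤ (0≤fromℕ 2) q≤2g)) L≤Lg ⟩
        fromℕ 8 * g + fromℕ 2 * (fromℕ 2 * g) + L * g
          ≈⟨ solve 2 (λ g L → nat 8 :* g :+ nat 2 :* (nat 2 :* g) :+ L :* g := nat 12 :* (con 1 :* g) :+ L :* g) refl g L ⟩
        fromℕ 12 * (1# * g) + L * g
          ≤⟨ +-monoˡ-≤ _ _ _ (*-monoʳ-≤ (0≤fromℕ 12) (*-monoˡ-≤ 0≤g 1≤2loglog)) ⟩
        fromℕ 12 * (fromℕ 2 * L * g) + L * g
          ≈⟨ solve 2 (λ g L → nat 12 :* (nat 2 :* L :* g) :+ L :* g := nat 25 :* (L :* g)) refl g L ⟩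
        fromℕ 25 * (L * g) ∎
        where
        0≤g : 0# ≤ g
        0≤g = ≤-trans 0≤1 1≤g
        8≤8g : fromℕ 8 ≤ fromℕ 8 * g
        8≤8g = ≤-trans (≤-reflexive (sym (*-identityʳ _))) (*-monoʳ-≤ (0≤fromℕ 8) 1≤g)
        L≤Lg : L ≤ L * g
        L≤Lg = ≤-trans (≤-reflexive (sym (*-identityʳ _))) (*-monoʳ-≤ (proj₁ 0<loglog) 1≤g)

      module _ (p : ℕ) {{p≢0 : ℕ.NonZero p}} (p≤4y : fromℕ p ≤ fromℕ 4 * y) (S : SampleCount p n₃) where
        open SampleCount S

        -- The number 2pD is O(y² log n), and only its logarithm enters the sample count: this is
        -- where log n becomes log log n.
        suc-a≤ : fromℕ (suc a) ≤ fromℕ 8 + fromℕ 2 * q + L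
        suc-a≤ = begin
          1# + fromℕ a
            ≤⟨ +-monoʳ-≤ 1# (pow≤⇒≤log {a} 2^a≤128yyR) ⟩
          1# + log₂ (fromℕ 128 * (y * y * R))
            ≈⟨ +-congˡ (log₂-* _ _ (0<fromℕ 128) (*-positive (*-positive 0<y 0<y) 0<log)) ⟩
          1# + (log₂ (fromℕ 128) + log₂ (y * y * R))
            ≈⟨ +-congˡ (+-cong (log₂-2^ 7) (trans (log₂-* _ _ (*-positive 0<y 0<y) 0<log) (+-congʳ (log₂-* y y 0<y 0<y)))) ⟩
          1# + (fromℕ 7 + (q + q + L))
            ≈⟨ solve 2 (λ q L → con 1 :+ (nat 7 :+ (q :+ q :+ L)) := nat 8 :+ nat 2 :* q :+ L) refl q L ⟩
          fromℕ 8 + fromℕ 2 * q + L ∎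
          where
          P = fromℕ p
          1+e≤2R : fromℕ (suc e) ≤ fromℕ 2 * R
          1+e≤2R = begin
            1# + fromℕ e ≤⟨ +-mono-≤ 1≤log (pow≤⇒≤log {e} (fromℕ-mono 2^e≤)) ⟩
            R + R        ≈⟨ solve 1 (λ R → R :+ R := nat 2 :* R) refl R ⟩
            fromℕ 2 * R  ∎
          1+p≤2p : fromℕ (suc p) ≤ fromℕ 2 * P
          1+p≤2p = begin
            1# + P       ≤⟨ +-monoˡ-≤ 1# P P (1≤fromℕ p) ⟩
            P + P        ≈⟨ solve 1 (λ R → R :+ R := nat 2 :* R) refl P ⟩
            fromℕ 2 * P  ∎
          0≤P : 0# ≤ P
          0≤P = 0≤fromℕ p
          0≤2P : 0# ≤ fromℕ 2 * P
          0≤2P = *-nonNegative _ _ (0≤fromℕ 2) 0≤P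
          0≤2R : 0# ≤ fromℕ 2 * R
          0≤2R = *-nonNegative _ _ (0≤fromℕ 2) (proj₁ 0<log)
          0≤4y : 0# ≤ fromℕ 4 * y
          0≤4y = *-nonNegative _ _ (0≤fromℕ 4) (proj₁ 0<y)
          2^a≤128yyR : fromℕ (2 ℕ.^ a) ≤ fromℕ 128 * (y * y * R)
          2^a≤128yyR = begin
            fromℕ (2 ℕ.^ a)
              ≤⟨ fromℕ-mono 2^a≤ ⟩
            fromℕ (2 ℕ.* p ℕ.* (suc p ℕ.* suc e))
              ≈⟨ trans (fromℕ-* (2 ℕ.* p) _) (*-cong (fromℕ-* 2 p) (fromℕ-* (suc p) (suc e))) ⟩
            fromℕ 2 * P * (fromℕ (suc p) * fromℕ (suc e))
              ≤⟨ *-monoʳ-≤ 0≤2P (*-mono-≤ 0≤2P (0≤fromℕ (suc e)) 1+p≤2p 1+e≤2R) ⟩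
            fromℕ 2 * P * (fromℕ 2 * P * (fromℕ 2 * R))
              ≈⟨ solve 2 (λ P R → nat 2 :* P :* (nat 2 :* P :* (nat 2 :* R)) := nat 4 :* (P :* P) :* (nat 2 :* R)) refl P R ⟩
            fromℕ 4 * (P * P) * (fromℕ 2 * R)
              ≤⟨ *-monoˡ-≤ 0≤2R (*-monoʳ-≤ (0≤fromℕ 4) (*-mono-≤ 0≤4y 0≤P p≤4y p≤4y)) ⟩
            fromℕ 4 * (fromℕ 4 * y * (fromℕ 4 * y)) * (fromℕ 2 * R)
              ≈⟨ solve 2 (λ y R → nat 4 :* (nat 4 :* y :* (nat 4 :* y)) :* (nat 2 :* R) := nat 128 :* (y :* y :* R)) refl y R ⟩
            fromℕ 128 * (y * y * R) ∎

        sampleCount≤ : fromℕ (suc l) ≤ fromℕ 200 * s * g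
        sampleCount≤ = begin
          fromℕ (suc l)
            ≤⟨ fromℕ-mono {suc l} {2 ℕ.* (p ℕ.* suc a)} 1+l≤2l ⟩
          fromℕ (2 ℕ.* (p ℕ.* suc a))
            ≈⟨ trans (fromℕ-* 2 (p ℕ.* suc a)) (*-congˡ (fromℕ-* p (suc a))) ⟩
          fromℕ 2 * (fromℕ p * fromℕ (suc a))
            ≤⟨ *-monoʳ-≤ (0≤fromℕ 2) (*-mono-≤ (*-nonNegative _ _ (0≤fromℕ 4) (proj₁ 0<y)) (0≤fromℕ (suc a))
                 p≤4y (≤-trans suc-a≤ exponent≤)) ⟩
          fromℕ 2 * (fromℕ 4 * y * (fromℕ 25 * (L * g)))
            ≈⟨ solve 3 (λ y L g → nat 2 :* (nat 4 :* y :* (nat 25 :* (L :* g))) := nat 200 :* (y :* L) :* g) refl y L g ⟩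
          fromℕ 200 * s * g ∎
          where
          1+l≤2l : suc (p ℕ.* suc a) ℕ.≤ 2 ℕ.* (p ℕ.* suc a)
          1+l≤2l = ℕ.+-mono-≤ {1} (ℕ.>-nonZero⁻¹ (p ℕ.* suc a) {{ℕ.m*n≢0 p (suc a)}}) (ℕ.m≤m+n (p ℕ.* suc a) 0)

      -- The lower bound on `p` makes the ratio (3 + p)/p of `∑-covered≤` at most 1 + ν; the upper
      -- bound keeps `p` in O(1/ν).
      record ReciprocalBound : Set ℓ₂ where
        field
          p       : ℕ
          p≢0     : ℕ.NonZero p
          3≤pν    : fromℕ 3 ≤ fromℕ p * ν
          p≤4y    : fromℕ p ≤ fromℕ 4 * y

      reciprocalBound : ReciprocalBound
      reciprocalBound with ⌈ fromℕ 3 * y ⌉ (*-nonNegative _ _ (0≤fromℕ 3) (proj₁ 0<y))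
      ... | p , 3y≤p , p≤3y+1 = record
        { p    = p
        ; p≢0  = ℕ.≢-nonZero λ { ≡.refl → <⇒≱ (*-positive (0<fromℕ 3) 0<y) 3y≤p }
        ; 3≤pν = begin
            fromℕ 3              ≈⟨ *-identityʳ _ ⟨
            fromℕ 3 * 1#         ≈⟨ *-congˡ (⁻¹-inverseˡ 0<ν) ⟨
            fromℕ 3 * (y * ν)    ≈⟨ *-assoc _ _ _ ⟨
            fromℕ 3 * y * ν      ≤⟨ *-monoˡ-≤ (proj₁ 0<ν) 3y≤p ⟩
            fromℕ p * ν          ∎
        ; p≤4y = begin
            fromℕ p              ≤⟨ p≤3y+1 ⟩
            fromℕ 3 * y + 1#     ≤⟨ +-monoʳ-≤ _ 1≤y ⟩
            fromℕ 3 * y + y      ≈⟨ solve 1 (λ y → nat 3 :* y :+ y := nat 4 :* y) refl y ⟩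
            fromℕ 4 * y          ∎
        }

-- Duplicate-free lists and finite subsets.

-- Serves to bound the number and the weight of edges by sums over a list that may repeat pairs;
-- `zs` is the surplus.
Unique-⊆⇒↭ : ∀ {xs ys : List A} → Unique xs → (∀ {x} → x ∈ xs → x ∈ ys) → ∃ λ zs → ys ↭ xs ++ zs
Unique-⊆⇒↭ {xs = []}     {ys} _          _     = ys , ↭-refl
Unique-⊆⇒↭ {xs = x ∷ xs} {ys} (x∉xs ∷ uniq) xs⊆ys with ∈-∃++ (xs⊆ys (here ≡.refl))
... | us , vs , ≡.refl with Unique-⊆⇒↭ {ys = us ++ vs} uniq xs⊆us++vs
  where
  xs⊆us++vs : ∀ {z} → z ∈ xs → z ∈ us ++ vs
  xs⊆us++vs z∈xs with ∈-resp-↭ (shift x us vs) (xs⊆ys (there z∈xs))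
  ... | here ≡.refl = contradiction ≡.refl (All.lookup x∉xs z∈xs)
  ... | there z∈    = z∈
...   | zs , p = zs , ↭-trans (shift x us vs) (↭-prep x p)

Unique-⊆⇒length≤ : ∀ {xs ys : List A} → Unique xs → (∀ {x} → x ∈ xs → x ∈ ys) → length xs ℕ.≤ length ys
Unique-⊆⇒length≤ {xs = xs} {ys} uniq xs⊆ys with Unique-⊆⇒↭ uniq xs⊆ys
... | zs , p = begin
  length xs                ≤⟨ ℕ.m≤m+n (length xs) (length zs) ⟩
  length xs ℕ.+ length zs  ≡⟨ length-++ xs ⟨
  length (xs ++ zs)        ≡⟨ ↭-length p ⟨
  length ys                ∎
  where open ℕ.≤-Reasoning

length-filter≡∑ : ∀ {p} {P : Pred A p} (P? : Decidable P) xs → length (filter P? xs) ≡ ∑ℕ xs (λ x → ⟦ does (P? x) ⟧)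
length-filter≡∑ P? []       = ≡.refl
length-filter≡∑ P? (x ∷ xs) with does (P? x)
... | true  = cong suc (length-filter≡∑ P? xs)
... | false = length-filter≡∑ P? xs

∣∣≡∑ : ∀ {n} (S : Subset n) → ∣ S ∣ ≡ ∑ℕ (allFin n) (λ x → ⟦ Vec.lookup S x ⟧)
∣∣≡∑ S = go S id _ λ _ → ≡.refl
  where
  go : ∀ {n} (S : Subset n) (g : Fin n → A) f → (∀ i → f (g i) ≡ ⟦ Vec.lookup S i ⟧) → ∣ S ∣ ≡ ∑ℕ (tabulate g) f
  go Vec.[]              g f e = ≡.refl
  go (inside  Vec.∷ S)   g f e rewrite e Fin.zero = cong suc (go S (g ∘ Fin.suc) f (e ∘ Fin.suc))
  go (outside Vec.∷ S)   g f e rewrite e Fin.zero = go S (g ∘ Fin.suc) f (e ∘ Fin.suc)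

module _ {n : ℕ} where
  open DecMembership (Fin._≟_ {n}) using (_∈?_)

  fromList : List (Fin n) → Subset n
  fromList xs = Vec.tabulate λ x → does (x ∈? xs)

  lookup-fromList : ∀ xs x → Vec.lookup (fromList xs) x ≡ does (x ∈? xs)
  lookup-fromList xs x = Vec.lookup∘tabulate _ x

  ∈⇒∈-fromList : ∀ {xs x} → x ∈ xs → x Subset.∈ fromList xs
  ∈⇒∈-fromList {xs} {x} x∈xs = Vec.lookup⇒[]= x (fromList xs) (≡.trans (lookup-fromList xs x) (dec-true (x ∈? xs) x∈xs))

  ∣fromList∣≤ : ∀ xs → ∣ fromList xs ∣ ℕ.≤ length xs
  ∣fromList∣≤ xs = begin
    ∣ fromList xs ∣                                          ≡⟨ ∣∣≡∑ (fromList xs) ⟩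
    ∑ℕ (allFin n) (λ x → ⟦ Vec.lookup (fromList xs) x ⟧)     ≡⟨ ∑ℕ.∑-cong (allFin n) (cong ⟦_⟧ ∘ lookup-fromList xs) ⟩
    ∑ℕ (allFin n) (λ x → ⟦ does (x ∈? xs) ⟧)                 ≡⟨ length-filter≡∑ (_∈? xs) (allFin n) ⟨
    length (filter (_∈? xs) (allFin n))                      ≤⟨ Unique-⊆⇒length≤ (Unique.filter⁺ (_∈? xs) (Unique.allFin⁺ n))
                                                                  (proj₂ ∘ ∈-filter⁻ (_∈? xs) {xs = allFin n}) ⟩
    length xs                                                ∎
    where open ℕ.≤-Reasoning

-- Bounds on graph distances; graphs weighted by the metric.

module Graphs {c ℓ₁ ℓ₂} (ℝ : RealNumbers c ℓ₁ ℓ₂) where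
  open RealNumbers ℝ hiding (zero)
  open Spanners ℝ
  open RealProperties ℝ

  open module ∑ℝ = Sums commutativeSemiring _≤_ isPartialOrder +-mono-≤ public
    using () renaming (∑ to ∑ℝ)

  module _ {n} {G : WeightedGraph n} where
    open WeightedGraph G

    Dist≤-weaken : ∀ {x y r s} → r ≤ s → Dist≤ G x y r → Dist≤ G x y s
    Dist≤-weaken r≤s (p , len≤r) = p , ≤-trans len≤r r≤s

    Dist≤-refl : ∀ {x} → Dist≤ G x x 0#
    Dist≤-refl = ε , ≤-refl

    Dist≤-edge : ∀ {x y} → Edge G x y → Dist≤ G x y (w x y)
    Dist≤-edge e = (e ◅ ε) , ≤-reflexive (+-identityʳ _)

    Dist≤-trans : ∀ {x y z r s} → Dist≤ G x y r → Dist≤ G y z s → Dist≤ G x z (r + s)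
    Dist≤-trans {x} {y} {z} {r} {s} (p , len≤r) q = Dist≤-weaken (+-monoˡ-≤ _ _ s len≤r) (go p q)
      where
      go : ∀ {x y} (p : Path G x y) → Dist≤ G y z s → Dist≤ G x z (pathLength G p + s)
      go ε       (q , len≤s) = q , ≤-trans len≤s (≤-reflexive (sym (+-identityˡ s)))
      go (e ◅ p) d with go p d
      ... | q , len≤ = e ◅ q , ≤-trans (+-monoʳ-≤ _ len≤) (≤-reflexive (sym (+-assoc _ _ s)))

    Dist≤-sym : ∀ {x y r} → Dist≤ G x y r → Dist≤ G y x r
    Dist≤-sym (p , len≤r) = Dist≤-weaken len≤r (reverse p)
      where
      reverse : ∀ {x y} (p : Path G x y) → Dist≤ G y x (pathLength G p)
      reverse ε               = Dist≤-refl
      reverse (_◅_ {x} {y} e p) = Dist≤-weaken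
        (≤-reflexive (trans (+-comm _ _) (+-congʳ (sym (w-sym x y e)))))
        (Dist≤-trans (reverse p) (Dist≤-edge (subst T (adj-sym x y) e)))

  weight≡∑ : ∀ {n} (G : WeightedGraph n) → weight G ≡ ∑ℝ (edges G) (λ (x , y) → WeightedGraph.w G x y)
  weight≡∑ G = go (edges G)
    where
    go : ∀ es → foldr _+_ 0# (map (λ (x , y) → WeightedGraph.w G x y) es) ≡ ∑ℝ es (λ (x , y) → WeightedGraph.w G x y)
    go []       = ≡.refl
    go (e ∷ es) = cong (_ +_) (go es)

  module _ {n} (G : WeightedGraph n) where
    private
      P? : Decidable (λ ((x , y) : Fin n × Fin n) → x Fin.< y × T (WeightedGraph.adj G x y))
      P? = λ (x , y) → (x Fin.<? y) ×-dec T? (WeightedGraph.adj G x y)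

    edges-unique : Unique (edges G)
    edges-unique = Unique.filter⁺ P? (Unique.cartesianProduct⁺ (Unique.allFin⁺ n) (Unique.allFin⁺ n))

    ∈-edges⁻ : ∀ {x y} → (x , y) ∈ edges G → Edge G x y
    ∈-edges⁻ e∈ = proj₂ (proj₂ (∈-filter⁻ P? {xs = cartesianProduct (allFin n) (allFin n)} e∈))

    ∈-edges⁺ : ∀ {x y} → x Fin.< y → Edge G x y → (x , y) ∈ edges G
    ∈-edges⁺ {x} {y} x<y e = ∈-filter⁺ P? (∈-cartesianProduct⁺ (∈-allFin x) (∈-allFin y)) (x<y , e)

  module DistanceGraph (X : FiniteMetricSpace) (E : List (Fin (FiniteMetricSpace.size X) × Fin (FiniteMetricSpace.size X)))
                       (E-sym : ∀ {x y} → (x , y) ∈ E → (y , x) ∈ E) where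
    open FiniteMetricSpace X
    open DecMembership (≡-dec (Fin._≟_ {size}) (Fin._≟_ {size})) using (_∈?_)

    -- The list `E` will be made of full squares of lists of samples, so it contains diagonal pairs,
    -- which must not become loops.
    adjacent? : ∀ x y → Dec (x ≢ y × (x , y) ∈ E)
    adjacent? x y = ¬? (x Fin.≟ y) ×-dec ((x , y) ∈? E)

    distanceGraph : WeightedGraph size
    distanceGraph = record
      { adj     = λ x y → does (adjacent? x y)
      ; adj-irr = λ x → dec-false (adjacent? x x) λ (x≢x , _) → x≢x ≡.refl
      ; adj-sym = λ x y → does-⇔ (mk⇔ (λ (x≢y , e) → x≢y ∘ ≡.sym , E-sym e) (λ (x≢y , e) → x≢y ∘ ≡.sym , E-sym e))
                                 (adjacent? x y) (adjacent? y x)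
      ; w       = d
      ; w-sym   = λ x y _ → d-sym x y
      ; w≥0     = λ x y _ → d≥0 x y
      }

    ∈⇒edge : ∀ {x y} → x ≢ y → (x , y) ∈ E → Edge distanceGraph x y
    ∈⇒edge {x} {y} x≢y e = subst T (≡.sym (dec-true (adjacent? x y) (x≢y , e))) _

    edge⇒∈ : ∀ {x y} → Edge distanceGraph x y → (x , y) ∈ E
    edge⇒∈ {x} {y} e = proj₂ (witness (adjacent? x y) e)
      where
      witness : ∀ {p} {P : Set p} (P? : Dec P) → T (does P?) → P
      witness (yes p) _ = p

    edges⊆E : ∀ {e} → e ∈ edges distanceGraph → e ∈ E
    edges⊆E = edge⇒∈ ∘ ∈-edges⁻ distanceGraph

    edgeCount≤ : edgeCount distanceGraph ℕ.≤ length E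
    edgeCount≤ = Unique-⊆⇒length≤ (edges-unique distanceGraph) edges⊆E

    weight≤ : weight distanceGraph ≤ ∑ℝ E (λ (x , y) → d x y)
    weight≤ with Unique-⊆⇒↭ (edges-unique distanceGraph) edges⊆E
    ... | zs , p = begin
      weight distanceGraph                                         ≡⟨ weight≡∑ distanceGraph ⟩
      ∑ℝ (edges distanceGraph) D                                   ≤⟨ x≤x+y (∑ℝ.∑-nonNegative zs λ {(x , y)} _ → d≥0 x y) ⟩
      ∑ℝ (edges distanceGraph) D + ∑ℝ zs D                         ≈⟨ ∑ℝ.∑-++ (edges distanceGraph) zs D ⟨
      ∑ℝ (edges distanceGraph ++ zs) D                             ≈⟨ ∑ℝ.∑-↭ D p ⟨
      ∑ℝ E D                                                       ∎
      where
      open ≤-Reasoning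
      D : Fin size × Fin size → Carrier
      D (x , y) = d x y

    distanceGraph-dominating : Dominating X distanceGraph
    distanceGraph-dominating x y ε = ≤-reflexive (Equivalence.from (d≈0⇔≡ x x) ≡.refl)
    distanceGraph-dominating x y (_◅_ {j = z} e p) =
      ≤-trans (triangle x z y) (+-monoʳ-≤ (d x z) (distanceGraph-dominating z y p))

    Dist≤-hop : ∀ B {x y} → (x , y) ∈ E → Vec.lookup B x ≡ false → Vec.lookup B y ≡ false →
                Dist≤ (induced distanceGraph (∁ B)) x y (d x y)
    Dist≤-hop B {x} {y} e x∉B y∉B with x Fin.≟ y
    -- Two nets may share a point; the hop is then the empty path.
    ... | yes ≡.refl = Dist≤-weaken (d≥0 x x) Dist≤-refl
    ... | no x≢y     = Dist≤-edge {G = induced distanceGraph (∁ B)}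
      (Equivalence.from Bool.T-∧ (∈⇒edge x≢y e , Equivalence.from Bool.T-∧ (alive x∉B , alive y∉B)))
      where
      alive : ∀ {z} → Vec.lookup B z ≡ false → T (Vec.lookup (∁ B) z)
      alive {z} z∉B = subst T (≡.sym (≡.trans (Vec.lookup-map z not B) (cong not z∉B))) _

length-cartesianProduct : ∀ {a b} {A : Set a} {B : Set b} (xs : List A) (ys : List B) →
  length (cartesianProduct xs ys) ≡ length xs ℕ.* length ys
length-cartesianProduct []       ys = ≡.refl
length-cartesianProduct (x ∷ xs) ys = ≡.trans (length-++ (map (x ,_) ys))
  (cong₂ ℕ._+_ (length-map (x ,_) ys) (length-cartesianProduct xs ys))

-- Hierarchies over the metric space and the edges of the spanner.

module Spanner {c ℓ₁ ℓ₂} (ℝ : RealNumbers c ℓ₁ ℓ₂) (X : Spanners.FiniteMetricSpace ℝ) where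
  open RealNumbers ℝ hiding (zero)
  open Spanners ℝ
  open RealProperties ℝ
  open Graphs ℝ
  open FiniteMetricSpace X

  Hier : Set c
  Hier = Hierarchy Carrier size

  rootLabel : Hier → Carrier
  rootLabel (leaf _)       = 0#
  rootLabel (branch Γ _ _) = Γ

  module _ (k : Carrier) (δ : ℕ) where
    -- The fields `diameter` and `split` are the two halves of the formula for `d` by least common
    -- ancestors, local to one branch and free of nodes.
    record ValidBranch (Γ : Carrier) (m : ℕ) (ts : Fin (suc m) → Hier) : Set (c ⊔ ℓ₁ ⊔ ℓ₂) where
      field
        label>0     : 0# < Γ
        degree≥2    : 2 ℕ.≤ suc m
        degree≤     : suc m ℕ.≤ δ
        antitone    : ∀ i → rootLabel (ts i) ≤ Γ
        separated   : ∀ i → k * rootLabel (ts i) ≤ Γ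
        diameter    : ∀ {x y} → x ∈ points (branch Γ m ts) → y ∈ points (branch Γ m ts) → d x y ≤ Γ
        split       : ∀ {i j x y} → i ≢ j → x ∈ points (ts i) → y ∈ points (ts j) → Γ ≤ d x y

      disjoint : ∀ {i j x} → i ≢ j → x ∈ points (ts i) → x ∉ points (ts j)
      disjoint {x = x} i≢j x∈i x∈j =
        <⇒≱ label>0 (≤-trans (split i≢j x∈i x∈j) (≤-reflexive (Equivalence.from (d≈0⇔≡ x x) ≡.refl)))

    data Valid : Hier → Set (c ⊔ ℓ₁ ⊔ ℓ₂) where
      leaf   : ∀ {x} → Valid (leaf x)
      branch : ∀ {Γ m ts} → ValidBranch Γ m ts → (∀ i → Valid (ts i)) → Valid (branch Γ m ts)

    rootLabel≥0 : ∀ {t} → Valid t → 0# ≤ rootLabel t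
    rootLabel≥0 leaf         = ≤-refl
    rootLabel≥0 (branch v _) = proj₁ (ValidBranch.label>0 v)

  children : ∀ m → List (Fin (suc m))
  children m = allFin (suc m)

  dist : Fin size × Fin size → Carrier
  dist (x , y) = d x y

  module Net (M : ℕ) (ω : List ℕ) where
    open Anchors {L = Carrier} {n = size} M

    cluster : Hier → List (Fin size)
    cluster t = map (sample (anchor t)) ω

    cluster⊆points : ∀ t {x} → x ∈ cluster t → x ∈ points t
    cluster⊆points t x∈ with ∈-map⁻ (sample (anchor t)) x∈
    ... | r , _ , ≡.refl = points-anchor⊆ t (∈-lookup {xs = points (anchor t)} _)

    -- Siblings are joined directly: a detour through the net of their parent
    -- would raise the stretch to 2 + 2/(k-1).
    slots : Carrier → (m : ℕ) → (Fin (suc m) → Hier) → List (Fin size)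
    slots Γ m ts = cluster (branch Γ m ts) ++ concatMap (λ i → cluster (ts i)) (children m)

    clique : Carrier → (m : ℕ) → (Fin (suc m) → Hier) → List (Fin size × Fin size)
    clique Γ m ts = cartesianProduct (slots Γ m ts) (slots Γ m ts)

    pairs : Hier → List (Fin size × Fin size)
    pairs (leaf x)         = []
    pairs (branch Γ m ts)  =
      clique Γ m ts ++ concatMap (λ i → pairs (ts i)) (children m)

    slots⊆points : ∀ Γ m ts {x} → x ∈ slots Γ m ts → x ∈ points (branch Γ m ts)
    slots⊆points Γ m ts x∈ with ∈-++⁻ (cluster (branch Γ m ts)) x∈
    ... | inj₁ x∈root = cluster⊆points (branch Γ m ts) x∈root
    ... | inj₂ x∈rest with ∈-children⁻ (λ i → cluster (ts i)) x∈rest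
    ...   | i , x∈i = ∈-children⁺ (λ i → points (ts i)) i (cluster⊆points (ts i) x∈i)

    pairs-sym : ∀ t {x y} → (x , y) ∈ pairs t → (y , x) ∈ pairs t
    pairs-sym (branch Γ m ts) e with ∈-++⁻ (clique Γ m ts) e
    ... | inj₁ e∈ with ∈-cartesianProduct⁻ (slots Γ m ts) (slots Γ m ts) e∈
    ...   | x∈ , y∈ = ∈-++⁺ˡ (∈-cartesianProduct⁺ y∈ x∈)
    pairs-sym (branch Γ m ts) e | inj₂ e∈ with ∈-children⁻ (λ i → pairs (ts i)) e∈
    ...   | i , e∈i = ∈-++⁺ʳ (clique Γ m ts) (∈-children⁺ (λ i → pairs (ts i)) i (pairs-sym (ts i) e∈i))

    l : ℕ
    l = length ω

    length-slots : ∀ Γ m ts → length (slots Γ m ts) ≡ (2 ℕ.+ m) ℕ.* l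
    length-slots Γ m ts = begin
      length (slots Γ m ts)
        ≡⟨ length-++ (cluster (branch Γ m ts)) ⟩
      length (cluster (branch Γ m ts)) ℕ.+ length (concatMap (λ i → cluster (ts i)) (children m))
        ≡⟨ cong₂ ℕ._+_ (length-map _ ω) (length-concatMap (λ i → cluster (ts i)) (children m)) ⟩
      l ℕ.+ ∑ℕ (children m) (λ i → length (cluster (ts i)))
        ≡⟨ cong (l ℕ.+_) (∑ℕ.∑-cong (children m) (λ i → ≡.trans (length-map _ ω) (≡.sym (ℕ.+-identityʳ l)))) ⟩
      l ℕ.+ ∑ℕ (children m) (λ i → 1 ℕ.* l)
        ≡⟨ cong (l ℕ.+_) (∑ℕ.∑-*ʳ l (children m) (λ _ → 1)) ⟨
      l ℕ.+ ∑ℕ (children m) (λ i → 1) ℕ.* l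
        ≡⟨ cong (λ z → l ℕ.+ z ℕ.* l) (≡.trans (∑-1 (children m)) (length-tabulate {n = suc m} id)) ⟩
      (2 ℕ.+ m) ℕ.* l ∎
      where open ≡.≡-Reasoning

    module _ (δ : ℕ) where
      -- The share of a clique that falls to each child: a node with c children has (c+1)l ≤ 2cl
      -- slots, hence at most 4c²l² pairs, and one factor c is bounded by `δ`.
      unit : ℕ
      unit = 4 ℕ.* δ ℕ.* (l ℕ.* l)

      clique≤ : ∀ Γ m ts → 2 ℕ.≤ suc m → suc m ℕ.≤ δ →
        length (clique Γ m ts) ℕ.≤ unit ℕ.* suc m
      clique≤ Γ m ts 2≤ m<δ = begin
        length (clique Γ m ts)
          ≡⟨ length-cartesianProduct (slots Γ m ts) (slots Γ m ts) ⟩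
        length (slots Γ m ts) ℕ.* length (slots Γ m ts)
          ≡⟨ cong₂ ℕ._*_ (length-slots Γ m ts) (length-slots Γ m ts) ⟩
        (2 ℕ.+ m) ℕ.* l ℕ.* ((2 ℕ.+ m) ℕ.* l)
          ≤⟨ ℕ.*-mono-≤ step step ⟩
        2 ℕ.* suc m ℕ.* l ℕ.* (2 ℕ.* suc m ℕ.* l)
          ≡⟨ rearrange (suc m) l ⟩
        4 ℕ.* suc m ℕ.* (l ℕ.* l) ℕ.* suc m
          ≤⟨ ℕ.*-monoˡ-≤ (suc m) (ℕ.*-monoˡ-≤ (l ℕ.* l) (ℕ.*-monoʳ-≤ 4 m<δ)) ⟩
        unit ℕ.* suc m ∎
        where
        open ℕ.≤-Reasoning
        step : (2 ℕ.+ m) ℕ.* l ℕ.≤ 2 ℕ.* suc m ℕ.* l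
        step = ℕ.*-monoˡ-≤ l (begin
          suc (suc m)          ≤⟨ ℕ.+-monoˡ-≤ (suc m) (ℕ.≤-trans (ℕ.n≤1+n 1) 2≤) ⟩
          suc m ℕ.+ suc m      ≡⟨ cong (suc m ℕ.+_) (ℕ.+-identityʳ (suc m)) ⟨
          2 ℕ.* suc m          ∎)
        rearrange : ∀ x l → 2 ℕ.* x ℕ.* l ℕ.* (2 ℕ.* x ℕ.* l) ≡ 4 ℕ.* x ℕ.* (l ℕ.* l) ℕ.* x
        rearrange = solve-∀

      -- A tree whose internal nodes have at least two children has at most
      -- 2 (#leaves) - 2 edges.
      length-pairs≤ : ∀ {k t} → Valid k δ t → length (pairs t) ℕ.+ 2 ℕ.* unit ℕ.≤ 2 ℕ.* unit ℕ.* #points t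
      length-pairs≤ leaf = ℕ.≤-reflexive (≡.sym (ℕ.*-identityʳ _))
      length-pairs≤ {t = branch Γ m ts} (branch v vs) = begin
        length (pairs (branch Γ m ts)) ℕ.+ 2 ℕ.* u
          ≡⟨ cong (ℕ._+ 2 ℕ.* u) (≡.trans (length-++ (clique Γ m ts))
               (cong (length (clique Γ m ts) ℕ.+_) (length-concatMap (λ i → pairs (ts i)) (children m)))) ⟩
        length (clique Γ m ts) ℕ.+ P ℕ.+ 2 ℕ.* u
          ≤⟨ ℕ.+-monoˡ-≤ (2 ℕ.* u) (ℕ.+-monoˡ-≤ P (clique≤ Γ m ts degree≥2 degree≤)) ⟩
        u ℕ.* suc m ℕ.+ P ℕ.+ 2 ℕ.* u
          ≡⟨ rearrange u P (suc m) ⟩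
        P ℕ.+ (u ℕ.* suc m ℕ.+ u ℕ.* 2)
          ≤⟨ ℕ.+-monoʳ-≤ P (ℕ.+-monoʳ-≤ (u ℕ.* suc m) (ℕ.*-monoʳ-≤ u degree≥2)) ⟩
        P ℕ.+ (u ℕ.* suc m ℕ.+ u ℕ.* suc m)
          ≡⟨ rearrange₂ u P (suc m) ⟩
        P ℕ.+ suc m ℕ.* (2 ℕ.* u)
          ≡⟨ cong (λ z → P ℕ.+ z ℕ.* (2 ℕ.* u)) (≡.trans (∑-1 (children m)) (length-tabulate {n = suc m} id)) ⟨
        P ℕ.+ ∑ℕ (children m) (λ _ → 1) ℕ.* (2 ℕ.* u)
          ≡⟨ cong (P ℕ.+_) (≡.trans (∑ℕ.∑-*ʳ (2 ℕ.* u) (children m) (λ _ → 1)) (∑ℕ.∑-cong (children m) λ _ → ℕ.+-identityʳ (2 ℕ.* u))) ⟩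
        P ℕ.+ ∑ℕ (children m) (λ _ → 2 ℕ.* u)
          ≡⟨ ∑ℕ.∑-+ (children m) (λ i → length (pairs (ts i))) (λ _ → 2 ℕ.* u) ⟨
        ∑ℕ (children m) (λ i → length (pairs (ts i)) ℕ.+ 2 ℕ.* u)
          ≤⟨ ∑ℕ.∑-mono (children m) (λ {i} _ → length-pairs≤ (vs i)) ⟩
        ∑ℕ (children m) (λ i → 2 ℕ.* u ℕ.* #points (ts i))
          ≡⟨ ∑ℕ.∑-*ˡ (2 ℕ.* u) (children m) (λ i → #points (ts i)) ⟨
        2 ℕ.* u ℕ.* ∑ℕ (children m) (λ i → #points (ts i))
          ≡⟨ cong (2 ℕ.* u ℕ.*_) (length-concatMap (λ i → points (ts i)) (children m)) ⟨
        2 ℕ.* u ℕ.* #points (branch Γ m ts) ∎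
        where
        open ℕ.≤-Reasoning
        open ValidBranch v
        u = unit
        P = ∑ℕ (children m) (λ i → length (pairs (ts i)))
        rearrange : ∀ u P x → u ℕ.* x ℕ.+ P ℕ.+ 2 ℕ.* u ≡ P ℕ.+ (u ℕ.* x ℕ.+ u ℕ.* 2)
        rearrange = solve-∀
        rearrange₂ : ∀ u P x → P ℕ.+ (u ℕ.* x ℕ.+ u ℕ.* x) ≡ P ℕ.+ x ℕ.* (2 ℕ.* u)
        rearrange₂ = solve-∀

  -- Each edge of the tree counts with the label of its upper end, which is what remains of the
  -- weight of the cliques once `unit` is factored out.
  labelSum : Hier → Carrier
  labelSum (leaf _)        = 0#
  labelSum (branch Γ m ts) = fromℕ (suc m) * Γ + ∑ℝ (children m) (λ i → labelSum (ts i))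

  ∑-const : ∀ {a} {A : Set a} (xs : List A) u → ∑ℝ xs (λ _ → u) ≈ fromℕ (length xs) * u
  ∑-const []       u = sym (zeroˡ u)
  ∑-const (x ∷ xs) u = trans (+-cong (sym (*-identityˡ u)) (∑-const xs u)) (sym (distribʳ u 1# _))

  ∑-children-const : ∀ m u → ∑ℝ (children m) (λ _ → u) ≈ fromℕ (suc m) * u
  ∑-children-const m u = subst (λ j → ∑ℝ (children m) (λ _ → u) ≈ fromℕ j * u)
    (length-tabulate {n = suc m} id) (∑-const (children m) u)

-- Lightness: labels against the weight of a spanning tree.

module Lightness {c ℓ₁ ℓ₂} (ℝ : RealNumbers c ℓ₁ ℓ₂) (X : Spanners.FiniteMetricSpace ℝ)
                 (k : RealNumbers.Carrier ℝ) (δ : ℕ) where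
  open RealNumbers ℝ hiding (zero)
  open Spanners ℝ
  open RealProperties ℝ
  open Graphs ℝ
  open FiniteMetricSpace X
  open Spanner ℝ X
  open DecMembership (Fin._≟_ {size}) using (_∈?_)

  module _ (M : ℕ) (ω : List ℕ) where
    open Net M ω

    clique-weight≤ : ∀ {Γ m ts} → ValidBranch k δ Γ m ts →
      ∑ℝ (clique Γ m ts) dist ≤ fromℕ (unit δ) * (fromℕ (suc m) * Γ)
    clique-weight≤ {Γ} {m} {ts} v = begin
      ∑ℝ (clique Γ m ts) dist
        ≤⟨ ∑ℝ.∑-mono (clique Γ m ts) within ⟩
      ∑ℝ (clique Γ m ts) (λ _ → Γ)
        ≈⟨ ∑-const (clique Γ m ts) Γ ⟩
      fromℕ (length (clique Γ m ts)) * Γ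
        ≤⟨ *-monoˡ-≤ (proj₁ label>0) (fromℕ-mono (clique≤ δ Γ m ts degree≥2 degree≤)) ⟩
      fromℕ (unit δ ℕ.* suc m) * Γ
        ≈⟨ *-congʳ (fromℕ-* (unit δ) (suc m)) ⟩
      fromℕ (unit δ) * fromℕ (suc m) * Γ
        ≈⟨ *-assoc _ _ _ ⟩
      fromℕ (unit δ) * (fromℕ (suc m) * Γ) ∎
      where
      open ≤-Reasoning
      open ValidBranch v
      within : ∀ {e} → e ∈ clique Γ m ts → dist e ≤ Γ
      within e∈ with ∈-cartesianProduct⁻ (slots Γ m ts) (slots Γ m ts) e∈
      ... | x∈ , y∈ = diameter (slots⊆points Γ m ts x∈) (slots⊆points Γ m ts y∈)

    pairs-weight≤ : ∀ {t} → Valid k δ t → ∑ℝ (pairs t) dist ≤ fromℕ (unit δ) * labelSum t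
    pairs-weight≤ leaf = ≤-reflexive (sym (zeroʳ _))
    pairs-weight≤ {branch Γ m ts} (branch v vs) = begin
      ∑ℝ (clique Γ m ts ++ concatMap (λ i → pairs (ts i)) (children m)) dist
        ≈⟨ ∑ℝ.∑-++ (clique Γ m ts) _ dist ⟩
      ∑ℝ (clique Γ m ts) dist + ∑ℝ (concatMap (λ i → pairs (ts i)) (children m)) dist
        ≈⟨ +-congˡ (∑ℝ.∑-concatMap (λ i → pairs (ts i)) (children m) dist) ⟩
      ∑ℝ (clique Γ m ts) dist + ∑ℝ (children m) (λ i → ∑ℝ (pairs (ts i)) dist)
        ≤⟨ +-mono-≤ (clique-weight≤ v) (∑ℝ.∑-mono (children m) λ {i} _ → pairs-weight≤ (vs i)) ⟩
      fromℕ (unit δ) * (fromℕ (suc m) * Γ) + ∑ℝ (children m) (λ i → fromℕ (unit δ) * labelSum (ts i))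
        ≈⟨ +-congˡ (∑ℝ.∑-*ˡ (fromℕ (unit δ)) (children m) (λ i → labelSum (ts i))) ⟨
      fromℕ (unit δ) * (fromℕ (suc m) * Γ) + fromℕ (unit δ) * ∑ℝ (children m) (λ i → labelSum (ts i))
        ≈⟨ distribˡ _ _ _ ⟨
      fromℕ (unit δ) * labelSum (branch Γ m ts) ∎
      where open ≤-Reasoning

  gap : ∀ Γ {m} (ts : Fin (suc m) → Hier) → Fin (suc m) → Carrier
  gap Γ ts i = Γ - rootLabel (ts i)

  gapSum : Hier → Carrier
  gapSum (leaf _)        = 0#
  gapSum (branch Γ m ts) = ∑ℝ (children m) λ i → gap Γ ts i + gapSum (ts i)

  -- In `gapSum` the label of a branch is added once per child and, except at the root, subtracted
  -- once. Its coefficient is thus at least degree - 1, which is at least half the degree. The root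
  -- is spared the subtraction, which makes the induction go through with its label added twice on
  -- the left.
  labelSum≤gapSum : ∀ {t} → Valid k δ t → fromℕ 2 * rootLabel t + labelSum t ≤ fromℕ 2 * gapSum t
  labelSum≤gapSum leaf = ≤-reflexive (+-identityʳ _)
  labelSum≤gapSum {branch Γ m ts} (branch v vs) = begin
    fromℕ 2 * Γ + (fromℕ (suc m) * Γ + S)
      ≤⟨ +-monoˡ-≤ _ _ _ (*-monoˡ-≤ (proj₁ label>0) (fromℕ-mono degree≥2)) ⟩
    fromℕ (suc m) * Γ + (fromℕ (suc m) * Γ + S)
      ≈⟨ solve 3 (λ m Γ S → m :* Γ :+ (m :* Γ :+ S) := m :* (nat 2 :* Γ) :+ S) refl (fromℕ (suc m)) Γ S ⟩
    fromℕ (suc m) * (fromℕ 2 * Γ) + S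
      ≈⟨ +-congʳ (∑-children-const m (fromℕ 2 * Γ)) ⟨
    ∑ℝ (children m) (λ _ → fromℕ 2 * Γ) + S
      ≈⟨ ∑ℝ.∑-+ (children m) (λ _ → fromℕ 2 * Γ) (λ i → labelSum (ts i)) ⟨
    ∑ℝ (children m) (λ i → fromℕ 2 * Γ + labelSum (ts i))
      ≤⟨ ∑ℝ.∑-mono (children m) (λ {i} _ → step i) ⟩
    ∑ℝ (children m) (λ i → fromℕ 2 * (gap Γ ts i + gapSum (ts i)))
      ≈⟨ ∑ℝ.∑-*ˡ (fromℕ 2) (children m) (λ i → gap Γ ts i + gapSum (ts i)) ⟨
    fromℕ 2 * gapSum (branch Γ m ts) ∎
    where
    open ≤-Reasoning
    open ValidBranch v
    S = ∑ℝ (children m) (λ i → labelSum (ts i))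
    step : ∀ i → fromℕ 2 * Γ + labelSum (ts i) ≤ fromℕ 2 * (gap Γ ts i + gapSum (ts i))
    step i = begin
      fromℕ 2 * Γ + labelSum (ts i)
        ≈⟨ +-congʳ (*-congˡ (x-y+y≈x Γ (rootLabel (ts i)))) ⟨
      fromℕ 2 * (gap Γ ts i + rootLabel (ts i)) + labelSum (ts i)
        ≈⟨ solve 3 (λ g l S → nat 2 :* (g :+ l) :+ S := nat 2 :* g :+ (nat 2 :* l :+ S)) refl (gap Γ ts i) (rootLabel (ts i)) (labelSum (ts i)) ⟩
      fromℕ 2 * gap Γ ts i + (fromℕ 2 * rootLabel (ts i) + labelSum (ts i))
        ≤⟨ +-monoʳ-≤ _ (labelSum≤gapSum (vs i)) ⟩
      fromℕ 2 * gap Γ ts i + fromℕ 2 * gapSum (ts i)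
        ≈⟨ distribˡ _ _ _ ⟨
      fromℕ 2 * (gap Γ ts i + gapSum (ts i)) ∎

  exitFee : List (Fin size) → Carrier → Fin size → Fin size → Carrier
  exitFee S g x y = if does (x ∈? S) then (if does (y ∈? S) then 0# else g) else 0#

  exitFee-inside : ∀ S g {x y} → y ∈ S → exitFee S g x y ≈ 0#
  exitFee-inside S g {x} {y} y∈S with does (x ∈? S)
  ... | false = refl
  ... | true rewrite dec-true (y ∈? S) y∈S = refl

  exitFee-outside : ∀ S g {x y} → x ∉ S → exitFee S g x y ≈ 0#
  exitFee-outside S g {x} x∉S rewrite dec-false (x ∈? S) x∉S = refl

  exitFee-exit : ∀ S g {x y} → x ∈ S → y ∉ S → exitFee S g x y ≈ g
  exitFee-exit S g {x} {y} x∈S y∉S rewrite dec-true (x ∈? S) x∈S | dec-false (y ∈? S) y∉S = refl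

  exitFee≥0 : ∀ S {g} x y → 0# ≤ g → 0# ≤ exitFee S g x y
  exitFee≥0 S x y 0≤g with does (x ∈? S) | does (y ∈? S)
  ... | true  | true  = ≤-refl
  ... | true  | false = 0≤g
  ... | false | _     = ≤-refl

  -- The gaps of the nodes left when going from x up to the least common
  -- ancestor of x and y telescope to its label.
  toll : Hier → Fin size → Fin size → Carrier
  toll (leaf _)        x y = 0#
  toll (branch Γ m ts) x y = ∑ℝ (children m) λ i → exitFee (points (ts i)) (gap Γ ts i) x y + toll (ts i) x y

  toll-outside : ∀ t {x y} → x ∉ points t → toll t x y ≤ 0#
  toll-outside (leaf _)        x∉ = ≤-refl
  toll-outside (branch Γ m ts) x∉ = ∑ℝ.∑-nonPositive (children m) λ {i} _ →
    let x∉i = λ x∈i → x∉ (∈-children⁺ (λ i → points (ts i)) i x∈i) in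
    ≤-trans (+-mono-≤ (≤-reflexive (exitFee-outside (points (ts i)) (gap Γ ts i) x∉i)) (toll-outside (ts i) x∉i))
            (≤-reflexive (+-identityʳ 0#))

  module _ {Γ m ts} (v : ValidBranch k δ Γ m ts) where
    open ValidBranch v
    open ≤-Reasoning

    toll≤child : ∀ {i x y} → x ∈ points (ts i) →
      toll (branch Γ m ts) x y ≤ exitFee (points (ts i)) (gap Γ ts i) x y + toll (ts i) x y
    toll≤child {i} {x} {y} x∈i = ∑ℝ.∑≤term (Unique.allFin⁺ (suc m)) (∈-allFin i) λ j j≢i →
      let x∉j = disjoint (j≢i ∘ ≡.sym) x∈i in
      ≤-trans (+-mono-≤ (≤-reflexive (exitFee-outside (points (ts j)) (gap Γ ts j) x∉j)) (toll-outside (ts j) x∉j))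
              (≤-reflexive (+-identityʳ 0#))

    toll≤label : ∀ {i x y} → x ∈ points (ts i) → y ∉ points (ts i) →
      toll (ts i) x y ≤ rootLabel (ts i) → toll (branch Γ m ts) x y ≤ Γ
    toll≤label {i} {x} {y} x∈i y∉i toll≤ = begin
      toll (branch Γ m ts) x y                                         ≤⟨ toll≤child x∈i ⟩
      exitFee (points (ts i)) (gap Γ ts i) x y + toll (ts i) x y       ≤⟨ +-mono-≤ (≤-reflexive (exitFee-exit (points (ts i)) (gap Γ ts i) x∈i y∉i)) toll≤ ⟩
      gap Γ ts i + rootLabel (ts i)                                        ≈⟨ x-y+y≈x Γ (rootLabel (ts i)) ⟩
      Γ                                                                ∎

  toll-exit : ∀ {t} → Valid k δ t → ∀ {x y} → x ∈ points t → y ∉ points t → toll t x y ≤ rootLabel t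
  toll-exit leaf _ _ = ≤-refl
  toll-exit {branch Γ m ts} (branch v vs) x∈ y∉ with ∈-children⁻ (λ i → points (ts i)) x∈
  ... | i , x∈i = toll≤label v x∈i y∉i (toll-exit (vs i) x∈i y∉i)
    where
    y∉i = λ y∈i → y∉ (∈-children⁺ (λ i → points (ts i)) i y∈i)

  -- While x and y share a child, that child charges nothing. Once they part, the whole ascent of x
  -- costs at most the label, which `split` bounds by the distance.
  toll-inside : ∀ {t} → Valid k δ t → ∀ {x y} → x ∈ points t → y ∈ points t → toll t x y ≤ d x y
  toll-inside leaf {x} {y} _ _ = d≥0 x y
  toll-inside {branch Γ m ts} (branch v vs) {x} {y} x∈ y∈
    with ∈-children⁻ (λ i → points (ts i)) x∈ | ∈-children⁻ (λ i → points (ts i)) y∈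
  ... | i , x∈i | j , y∈j with i Fin.≟ j
  ...   | yes ≡.refl = ≤-trans (toll≤child v x∈i) (≤-trans
            (+-mono-≤ (≤-reflexive (exitFee-inside (points (ts i)) (gap Γ ts i) y∈j)) (toll-inside (vs i) x∈i y∈j))
            (≤-reflexive (+-identityˡ _)))
  ...   | no i≢j     = ≤-trans (toll≤label v x∈i y∉i (toll-exit (vs i) x∈i y∉i)) (ValidBranch.split v i≢j x∈i y∈j)
    where
    y∉i = ValidBranch.disjoint v (i≢j ∘ ≡.sym) y∈j

  somePoint : ∀ (t : Hier) → ∃ λ x → x ∈ points t
  somePoint (leaf x)        = x , here ≡.refl
  somePoint (branch Γ m ts) with somePoint (ts Fin.zero)
  ... | x , x∈ = x , ∈-children⁺ (λ i → points (ts i)) Fin.zero x∈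

  -- Double counting: the tolls over `E` contain the gap of each proper subtree once per pair that
  -- leaves it, and `crossed` supplies such a pair.
  gapSum≤∑-toll : ∀ {t} → Valid k δ t → (E : List (Fin size × Fin size)) →
    (∀ S {x y} → x ∈ S → y ∉ S → ∃ λ e → e ∈ E × proj₁ e ∈ S × proj₂ e ∉ S) →
    gapSum t ≤ ∑ℝ E (λ (x , y) → toll t x y)
  gapSum≤∑-toll leaf E crossed = ≤-reflexive (sym (∑ℝ.∑-zero E))
  gapSum≤∑-toll {branch Γ m ts} (branch v vs) E crossed = begin
    ∑ℝ (children m) (λ i → gap Γ ts i + gapSum (ts i))
      ≤⟨ ∑ℝ.∑-mono (children m) (λ {i} _ → +-mono-≤ (paid i) (gapSum≤∑-toll (vs i) E crossed)) ⟩
    ∑ℝ (children m) (λ i → ∑ℝ E (fee i) + ∑ℝ E (λ (x , y) → toll (ts i) x y))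
      ≈⟨ ∑ℝ.∑-cong (children m) (λ i → sym (∑ℝ.∑-+ E (fee i) _)) ⟩
    ∑ℝ (children m) (λ i → ∑ℝ E (λ (x , y) → fee i (x , y) + toll (ts i) x y))
      ≈⟨ ∑ℝ.∑-swap (children m) E _ ⟩
    ∑ℝ E (λ (x , y) → toll (branch Γ m ts) x y) ∎
    where
    open ≤-Reasoning
    open ValidBranch v
    fee : Fin (suc m) → Fin size × Fin size → Carrier
    fee i (x , y) = exitFee (points (ts i)) (gap Γ ts i) x y
    sibling : ∀ {m} → 2 ℕ.≤ suc m → (i : Fin (suc m)) → ∃ λ j → i ≢ j
    sibling {suc m} _ Fin.zero    = Fin.suc Fin.zero , λ ()
    sibling {suc m} _ (Fin.suc i) = Fin.zero , λ ()
    sibling {zero}  (s≤s ()) _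
    paid : ∀ i → gap Γ ts i ≤ ∑ℝ E (fee i)
    -- A sibling provides a point outside the subtree, without which nothing would have to leave it.
    paid i with sibling degree≥2 i
    ... | j , i≢j with crossed (points (ts i)) (proj₂ (somePoint (ts i)))
                               (disjoint (i≢j ∘ ≡.sym) (proj₂ (somePoint (ts j))))
    ...   | e , e∈E , x∈ , y∉ = ≤-trans (≤-reflexive (sym (exitFee-exit (points (ts i)) (gap Γ ts i) x∈ y∉)))
              (∑ℝ.term≤∑ {f = fee i} (λ {(x , y)} _ → exitFee≥0 (points (ts i)) x y (0≤y-x (antitone i))) e∈E)

  module _ {N : WeightedGraph size} (N-isSpanningTree : IsSpanningTree X N) where
    open IsSpanningTree N-isSpanningTree
    open WeightedGraph N

    -- A toll is due only on the way up from the first endpoint, whereas `edges` lists each edge in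
    -- one order only, not necessarily the one that leaves the given subtree.
    bothDirections : List (Fin size × Fin size)
    bothDirections = edges N ++ map swap (edges N)

    edge∈ : ∀ {x y} → Edge N x y → (x , y) ∈ bothDirections
    edge∈ {x} {y} e with Fin.<-cmp x y
    ... | tri< x<y _ _    = ∈-++⁺ˡ (∈-edges⁺ N x<y e)
    ... | tri≈ _ ≡.refl _ = contradiction (subst T (adj-irr x) e) λ ()
    ... | tri> _ _ y<x    = ∈-++⁺ʳ (edges N) (∈-map⁺ swap (∈-edges⁺ N y<x (subst T (adj-sym x y) e)))

    crossing : ∀ S {x y} → Path N x y → x ∈ S → y ∉ S →
      ∃ λ e → e ∈ bothDirections × proj₁ e ∈ S × proj₂ e ∉ S
    crossing S ε x∈ y∉ = contradiction x∈ y∉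
    crossing S (_◅_ {x} {z} e p) x∈ y∉ with z ∈? S
    ... | yes z∈ = crossing S p z∈ y∉
    ... | no z∉  = (x , z) , edge∈ e , x∈ , z∉

    ∑-bothDirections : ∑ℝ bothDirections dist ≈ fromℕ 2 * weight N
    ∑-bothDirections = begin-equality
      ∑ℝ (edges N ++ map swap (edges N)) dist
        ≈⟨ ∑ℝ.∑-++ (edges N) _ dist ⟩
      ∑ℝ (edges N) dist + ∑ℝ (map swap (edges N)) dist
        ≈⟨ +-congˡ (trans (∑ℝ.∑-map swap (edges N) dist) (∑ℝ.∑-cong (edges N) λ (x , y) → d-sym y x)) ⟩
      ∑ℝ (edges N) dist + ∑ℝ (edges N) dist
        ≈⟨ +-cong ∑-dist ∑-dist ⟩
      weight N + weight N
        ≈⟨ solve 1 (λ W → W :+ W := nat 2 :* W) refl (weight N) ⟩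
      fromℕ 2 * weight N ∎
      where
      open ≤-Reasoning
      ∑-dist : ∑ℝ (edges N) dist ≈ weight N
      ∑-dist = trans
        (antisym (∑ℝ.∑-mono (edges N) λ e∈ → ≤-reflexive (sym (weights _ _ (∈-edges⁻ N e∈))))
                 (∑ℝ.∑-mono (edges N) λ e∈ → ≤-reflexive (weights _ _ (∈-edges⁻ N e∈))))
        (≡⇒≈˘ (weight≡∑ N))
        where
        ≡⇒≈˘ : ∀ {x y} → x ≡ y → y ≈ x
        ≡⇒≈˘ ≡.refl = refl

    -- One factor 2 is lost from labels to gaps, another by taking every edge in both directions.
    labelSum≤weight : ∀ {t} → Valid k δ t → (∀ x → x ∈ points t) → labelSum t ≤ fromℕ 4 * weight N
    labelSum≤weight {t} v total = begin
      labelSum t                          ≈⟨ +-identityˡ _ ⟨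
      0# + labelSum t                     ≤⟨ +-monoˡ-≤ _ _ _ (*-nonNegative _ _ (0≤fromℕ 2) (rootLabel≥0 k δ v)) ⟩
      fromℕ 2 * rootLabel t + labelSum t      ≤⟨ labelSum≤gapSum v ⟩
      fromℕ 2 * gapSum t                  ≤⟨ *-monoʳ-≤ (0≤fromℕ 2) (begin
        gapSum t                                    ≤⟨ gapSum≤∑-toll v bothDirections (λ S → crossing S (connected _ _)) ⟩
        ∑ℝ bothDirections (λ (x , y) → toll t x y)  ≤⟨ ∑ℝ.∑-mono bothDirections (λ {(x , y)} _ → toll-inside v (total x) (total y)) ⟩
        ∑ℝ bothDirections dist                      ≈⟨ ∑-bothDirections ⟩
        fromℕ 2 * weight N                          ∎) ⟩
      fromℕ 2 * (fromℕ 2 * weight N)      ≈⟨ solve 1 (λ W → nat 2 :* (nat 2 :* W) := nat 4 :* W) refl (weight N) ⟩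
      fromℕ 4 * weight N                  ∎
      where open ≤-Reasoning

-- Stretch between points that are not covered.

module Reliability {c ℓ₁ ℓ₂} (ℝ : RealNumbers c ℓ₁ ℓ₂) (X : Spanners.FiniteMetricSpace ℝ)
                   (k : RealNumbers.Carrier ℝ) (1<k : RealNumbers._<_ ℝ (RealNumbers.1# ℝ) k) (δ : ℕ)
                   (p : ℕ) (ω : List ℕ) (H : Hierarchy (RealNumbers.Carrier ℝ) (Spanners.FiniteMetricSpace.size X))
                   (B : Subset (Spanners.FiniteMetricSpace.size X)) where
  open RealNumbers ℝ hiding (zero)
  open Spanners ℝ
  open RealProperties ℝ
  open Graphs ℝ
  open FiniteMetricSpace X
  open Spanner ℝ X
  open Net (suc p) ω
  open Anchors {L = Carrier} {n = size} (suc p) using (anchor)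
  open Covering {L = Carrier} p (Vec.lookup B)
  open DistanceGraph X (pairs H) (pairs-sym H)
  open ValidBranch

  G : WeightedGraph size
  G = induced distanceGraph (∁ B)

  -- The geometric series 1/k + 1/k² + ..., which bounds the climb from a leaf to the net of a child
  -- in terms of the label of the parent.
  h : Carrier
  h = (k - 1#) ⁻¹

  0<k-1 : 0# < k - 1#
  0<k-1 = 0≤y-x (proj₁ 1<k) , λ 0≈k-1 → proj₂ 1<k
    (trans (sym (+-identityˡ 1#)) (trans (+-congʳ 0≈k-1) (x-y+y≈x k 1#)))

  0≤h : 0# ≤ h
  0≤h = 0≤⁻¹ 0<k-1

  hk≈1+h : h * k ≈ 1# + h
  hk≈1+h = begin-equality
    h * k                ≈⟨ *-congˡ (x-y+y≈x k 1#) ⟨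
    h * (k - 1# + 1#)    ≈⟨ distribˡ h (k - 1#) 1# ⟩
    h * (k - 1#) + h * 1# ≈⟨ +-cong (⁻¹-inverseˡ 0<k-1) (*-identityʳ h) ⟩
    1# + h               ∎
    where open ≤-Reasoning

  climb-step : ∀ {Γ m ts} → ValidBranch k δ Γ m ts → ∀ i → (1# + h) * rootLabel (ts i) ≤ h * Γ
  climb-step {Γ} {ts = ts} v i = begin
    (1# + h) * rootLabel (ts i) ≈⟨ *-congʳ hk≈1+h ⟨
    h * k * rootLabel (ts i)    ≈⟨ *-assoc h k _ ⟩
    h * (k * rootLabel (ts i))  ≤⟨ *-monoʳ-≤ 0≤h (separated v i) ⟩
    h * Γ                   ∎
    where open ≤-Reasoning

  ¬dead⇒survivor : ∀ t → dead ω t ≡ false → ∃ λ z → z ∈ cluster t × Vec.lookup B z ≡ false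
  ¬dead⇒survivor t = go ω
    where
    go : ∀ ω′ → all (λ r → Vec.lookup B (sample (anchor t) r)) ω′ ≡ false →
         ∃ λ z → z ∈ map (sample (anchor t)) ω′ × Vec.lookup B z ≡ false
    go (r ∷ ω′) e with Vec.lookup B (sample (anchor t) r) in inB
    ... | false = sample (anchor t) r , here ≡.refl , inB
    ... | true  with go ω′ e
    ...   | z , z∈ , z∉B = z , there z∈ , z∉B

  ∉covered⇒¬dead : ∀ t {x} → x ∈ points t → x ∉ covered ω t → dead ω t ≡ false
  ∉covered⇒¬dead (leaf y) x∈ x∉ with dead ω (leaf y)
  ... | true  = contradiction x∈ x∉
  ... | false = ≡.refl
  ∉covered⇒¬dead t@(branch Γ m ts) x∈ x∉ with dead ω t
  ... | true  = contradiction x∈ x∉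
  ... | false = ≡.refl

  ∉covered-child : ∀ Γ m ts i {x} → x ∈ points (ts i) → x ∉ covered ω (branch Γ m ts) → x ∉ covered ω (ts i)
  ∉covered-child Γ m ts i x∈ x∉ x∈i with dead ω (branch Γ m ts)
  ... | true  = x∉ (∈-children⁺ (λ i → points (ts i)) i x∈)
  ... | false = x∉ (∈-children⁺ (λ i → covered ω (ts i)) i x∈i)

  -- A leaf is its own anchor and all of its samples are the leaf itself, so a leaf in B is dead.
  covered⊇B : ∀ t {x} → x ∈ points t → Vec.lookup B x ≡ true → x ∈ covered ω t
  covered⊇B (leaf y) (here ≡.refl) y∈B with dead ω (leaf y) in alive
  ... | true  = here ≡.refl
  ... | false with ¬dead⇒survivor (leaf y) alive
  ...   | z , z∈ , z∉B with cluster⊆points (leaf y) z∈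
  ...     | here ≡.refl = contradiction (≡.trans (≡.sym y∈B) z∉B) λ ()
  covered⊇B t@(branch Γ m ts) x∈ x∈B with dead ω t
  ... | true  = x∈
  ... | false with ∈-children⁻ (λ i → points (ts i)) x∈
  ...   | i , x∈i = ∈-children⁺ (λ i → covered ω (ts i)) i (covered⊇B (ts i) x∈i x∈B)

  hop : ∀ {Γ m ts x y} → ValidBranch k δ Γ m ts → (∀ {e} → e ∈ pairs (branch Γ m ts) → e ∈ pairs H) →
        x ∈ slots Γ m ts → y ∈ slots Γ m ts → Vec.lookup B x ≡ false → Vec.lookup B y ≡ false →
        Dist≤ G x y Γ
  hop {Γ} {m} {ts} v ⊆H x∈ y∈ x∉B y∉B = Dist≤-weaken {G = G}
    (diameter v (slots⊆points Γ m ts x∈) (slots⊆points Γ m ts y∈))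
    (Dist≤-hop B (⊆H (∈-++⁺ˡ (∈-cartesianProduct⁺ x∈ y∈))) x∉B y∉B)

  child-slot : ∀ Γ m ts i {x} → x ∈ cluster (ts i) → x ∈ slots Γ m ts
  child-slot Γ m ts i x∈ = ∈-++⁺ʳ (cluster (branch Γ m ts)) (∈-children⁺ (λ i → cluster (ts i)) i x∈)

  child-pairs : ∀ Γ m ts i {e} → e ∈ pairs (ts i) → e ∈ pairs (branch Γ m ts)
  child-pairs Γ m ts i e∈ = ∈-++⁺ʳ (clique Γ m ts) (∈-children⁺ (λ i → pairs (ts i)) i e∈)

  -- Reaching the net of the child costs at most hΓ by `climb-step`, and the hop into the net of the
  -- parent at most Γ, so the factor 1 + h reproduces itself.
  climb : ∀ {t x z} → Valid k δ t → (∀ {e} → e ∈ pairs t → e ∈ pairs H) →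
          x ∈ points t → x ∉ covered ω t → z ∈ cluster t → Vec.lookup B z ≡ false →
          Dist≤ G x z ((1# + h) * rootLabel t)
  climb {leaf y} leaf ⊆H (here ≡.refl) _ z∈ _ with cluster⊆points (leaf y) z∈
  ... | here ≡.refl = Dist≤-weaken {G = G} (≤-reflexive (sym (zeroʳ _))) (Dist≤-refl {G = G})
  climb {branch Γ m ts} {x} {z} (branch v vs) ⊆H x∈ x∉ z∈ z∉B
    with ∈-children⁻ (λ i → points (ts i)) x∈
  ... | i , x∈i with ¬dead⇒survivor (ts i) (∉covered⇒¬dead (ts i) x∈i (∉covered-child Γ m ts i x∈i x∉))
  ...   | u , u∈ , u∉B = Dist≤-weaken {G = G} length≤ (Dist≤-trans {G = G}
      (climb (vs i) (⊆H ∘ child-pairs Γ m ts i) x∈i (∉covered-child Γ m ts i x∈i x∉) u∈ u∉B)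
      (hop v ⊆H (child-slot Γ m ts i u∈) (∈-++⁺ˡ z∈) u∉B z∉B))
    where
    open ≤-Reasoning
    length≤ : (1# + h) * rootLabel (ts i) + Γ ≤ (1# + h) * Γ
    length≤ = begin
      (1# + h) * rootLabel (ts i) + Γ ≤⟨ +-monoˡ-≤ _ _ Γ (climb-step v i) ⟩
      h * Γ + Γ                   ≈⟨ solve 2 (λ h Γ → h :* Γ :+ Γ := (con 1 :+ h) :* Γ) refl h Γ ⟩
      (1# + h) * Γ                ∎

  -- The graph remains that of the whole hierarchy `H` while the induction descends to the least
  -- common ancestor; hence the inclusion of `pairs t` as a hypothesis. There the three legs cost
  -- hΓ, Γ and hΓ.
  connect : ∀ {t x y} → Valid k δ t → (∀ {e} → e ∈ pairs t → e ∈ pairs H) →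
            x ∈ points t → y ∈ points t → x ∉ covered ω t → y ∉ covered ω t →
            Dist≤ G x y ((1# + fromℕ 2 * h) * d x y)
  connect {x = x} leaf _ (here ≡.refl) (here ≡.refl) _ _ = Dist≤-weaken {G = G}
    (*-nonNegative _ _ (+-nonNegative 0≤1 (*-nonNegative _ _ (0≤fromℕ 2) 0≤h)) (d≥0 x x)) (Dist≤-refl {G = G})
  connect {branch Γ m ts} {x} {y} (branch v vs) ⊆H x∈ y∈ x∉ y∉
    with ∈-children⁻ (λ i → points (ts i)) x∈ | ∈-children⁻ (λ i → points (ts i)) y∈
  ... | i , x∈i | j , y∈j with i Fin.≟ j
  ...   | yes ≡.refl = connect (vs i) (⊆H ∘ child-pairs Γ m ts i) x∈i y∈j
                         (∉covered-child Γ m ts i x∈i x∉) (∉covered-child Γ m ts i y∈j y∉)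
  ...   | no i≢j
    with ¬dead⇒survivor (ts i) (∉covered⇒¬dead (ts i) x∈i (∉covered-child Γ m ts i x∈i x∉))
       | ¬dead⇒survivor (ts j) (∉covered⇒¬dead (ts j) y∈j (∉covered-child Γ m ts j y∈j y∉))
  ...     | u , u∈ , u∉B | z , z∈ , z∉B = Dist≤-weaken {G = G} length≤
      (Dist≤-trans {G = G} (climb (vs i) (⊆H ∘ child-pairs Γ m ts i) x∈i (∉covered-child Γ m ts i x∈i x∉) u∈ u∉B)
      (Dist≤-trans {G = G} (hop v ⊆H (child-slot Γ m ts i u∈) (child-slot Γ m ts j z∈) u∉B z∉B)
      (Dist≤-sym {G = G} (climb (vs j) (⊆H ∘ child-pairs Γ m ts j) y∈j (∉covered-child Γ m ts j y∈j y∉) z∈ z∉B))))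
    where
    open ≤-Reasoning
    length≤ : (1# + h) * rootLabel (ts i) + (Γ + (1# + h) * rootLabel (ts j)) ≤ (1# + fromℕ 2 * h) * d x y
    length≤ = begin
      (1# + h) * rootLabel (ts i) + (Γ + (1# + h) * rootLabel (ts j))
        ≤⟨ +-mono-≤ (climb-step v i) (+-monoʳ-≤ Γ (climb-step v j)) ⟩
      h * Γ + (Γ + h * Γ)
        ≈⟨ solve 2 (λ h Γ → h :* Γ :+ (Γ :+ h :* Γ) := (con 1 :+ nat 2 :* h) :* Γ) refl h Γ ⟩
      (1# + fromℕ 2 * h) * Γ
        ≤⟨ *-monoʳ-≤ (+-nonNegative 0≤1 (*-nonNegative _ _ (0≤fromℕ 2) 0≤h)) (split v i≢j x∈i y∈j) ⟩
      (1# + fromℕ 2 * h) * d x y ∎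

-- From labelled trees with node predicates to hierarchies.

base≤foldr⊔ : ∀ {m} b (f : Fin m → ℕ) → b ℕ.≤ Vector.foldr ℕ._⊔_ b f
base≤foldr⊔ {zero}  b f = ℕ.≤-refl
base≤foldr⊔ {suc m} b f = ℕ.≤-trans (base≤foldr⊔ b (f ∘ Fin.suc)) (ℕ.m≤n⊔m (f Fin.zero) _)

term≤foldr⊔ : ∀ {m} b (f : Fin m → ℕ) i → f i ℕ.≤ Vector.foldr ℕ._⊔_ b f
term≤foldr⊔ b f Fin.zero    = ℕ.m≤m⊔n (f Fin.zero) _
term≤foldr⊔ b f (Fin.suc i) = ℕ.≤-trans (term≤foldr⊔ b (f ∘ Fin.suc) i) (ℕ.m≤n⊔m (f Fin.zero) _)

module FromTree {c ℓ₁ ℓ₂} (ℝ : RealNumbers c ℓ₁ ℓ₂) (X : Spanners.FiniteMetricSpace ℝ)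
                (k : RealNumbers.Carrier ℝ) (δ : ℕ) where
  open RealNumbers ℝ hiding (zero)
  open Spanners ℝ
  open RealProperties ℝ
  open FiniteMetricSpace X
  open Spanner ℝ X

  restrict : ∀ {Γ m} {ts : Fin m → Tree} → (Leaf (node Γ ts) → Fin size) → ∀ i → Leaf (ts i) → Fin size
  restrict ρ i (v , isLeaf) = ρ (child i v , isLeaf)

  hierarchy : (t : Tree) → (Leaf t → Fin size) → Hier
  hierarchy (node Γ {zero}  ts) ρ = leaf (ρ (root , ≡.refl))
  hierarchy (node Γ {suc m} ts) ρ = branch Γ m λ i → hierarchy (ts i) (restrict ρ i)

  ∈-hierarchy⁺ : ∀ t ρ u → ρ u ∈ points (hierarchy t ρ)
  ∈-hierarchy⁺ (node Γ {zero}  ts) ρ (root , ≡.refl) = here ≡.refl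
  ∈-hierarchy⁺ (node Γ {suc m} ts) ρ (child i v , isLeaf) =
    ∈-children⁺ (λ i → points (hierarchy (ts i) (restrict ρ i))) i (∈-hierarchy⁺ (ts i) (restrict ρ i) (v , isLeaf))

  ∈-hierarchy⁻ : ∀ t ρ {x} → x ∈ points (hierarchy t ρ) → ∃ λ u → ρ u ≡ x
  ∈-hierarchy⁻ (node Γ {zero}  ts) ρ (here ≡.refl) = (root , ≡.refl) , ≡.refl
  ∈-hierarchy⁻ (node Γ {suc m} ts) ρ x∈ with ∈-children⁻ (λ i → points (hierarchy (ts i) (restrict ρ i))) x∈
  ... | i , x∈i with ∈-hierarchy⁻ (ts i) (restrict ρ i) x∈i
  ...   | (v , isLeaf) , e = (child i v , isLeaf) , e

  lca-same : ∀ {Γ m} {ts : Fin m → Tree} i (u v : Node (ts i)) → lca {node Γ ts} (child i u) (child i v) ≡ child i (lca u v)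
  lca-same i u v with i Fin.≟ i
  ... | yes ≡.refl = ≡.refl
  ... | no i≢i     = contradiction ≡.refl i≢i

  lca-distinct : ∀ {Γ m} {ts : Fin m → Tree} {i j} → i ≢ j → (u : Node (ts i)) (v : Node (ts j)) →
                 lca {node Γ ts} (child i u) (child j v) ≡ root
  lca-distinct {i = i} {j} i≢j u v with i Fin.≟ j
  ... | yes i≡j = contradiction i≡j i≢j
  ... | no _    = ≡.refl

  -- The conditions on an HST in a form inherited by subtrees: the bijection with the points does
  -- not restrict, so it is replaced by a map from leaves to points, and distances are specified on
  -- leaves.
  record Represents (t : Tree) (ρ : Leaf t → Fin size) : Set (c ⊔ ℓ₁ ⊔ ℓ₂) where
    field
      label≥0         : (v : Node t) → 0# ≤ label v
      label≈0⇔leaf    : (v : Node t) → label v ≈ 0# ⇔ IsLeaf v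
      label-antitone  : (v : Node t) (i : Fin (degree v)) → label (childOf v i) ≤ label v
      degree≥2        : (v : Node t) → ¬ IsLeaf v → 2 ℕ.≤ degree v
      label-separated : (v : Node t) (i : Fin (degree v)) → k * label (childOf v i) ≤ label v
      d≈label-lca     : ∀ u v → d (ρ u) (ρ v) ≈ label (lca (proj₁ u) (proj₁ v))
      maxDegree≤      : maxDegree t ℕ.≤ δ

  subtree : ∀ {Γ m} {ts : Fin m → Tree} {ρ} → Represents (node Γ ts) ρ → ∀ i → Represents (ts i) (restrict ρ i)
  subtree {m = m} {ts} r i = record
    { label≥0         = label≥0 ∘ child i
    ; label≈0⇔leaf    = label≈0⇔leaf ∘ child i
    ; label-antitone  = label-antitone ∘ child i
    ; degree≥2        = degree≥2 ∘ child i
    ; label-separated = label-separated ∘ child i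
    ; d≈label-lca     = λ (u , lu) (v , lv) → trans (d≈label-lca (child i u , lu) (child i v , lv))
                                                    (reflexive (cong label (lca-same i u v)))
    ; maxDegree≤      = ℕ.≤-trans (term≤foldr⊔ m (λ i → maxDegree (ts i)) i) maxDegree≤
    }
    where open Represents r

  label≤root : ∀ t {ρ} → Represents t ρ → (v : Node t) → label v ≤ label {t} root
  label≤root t          r root        = ≤-refl
  label≤root (node Γ ts) r (child i v) =
    ≤-trans (label≤root (ts i) (subtree r i) v) (Represents.label-antitone r root i)

  rootLabel≈ : ∀ t {ρ} → Represents t ρ → rootLabel (hierarchy t ρ) ≈ label {t} root
  rootLabel≈ (node Γ {zero}  ts) r = sym (Equivalence.from (Represents.label≈0⇔leaf r root) ≡.refl)
  rootLabel≈ (node Γ {suc m} ts) r = refl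

  hierarchy-valid : ∀ t {ρ} → Represents t ρ → Valid k δ (hierarchy t ρ)
  hierarchy-valid (node Γ {zero}  ts)     r = leaf
  hierarchy-valid t@(node Γ {suc m} ts) {ρ} r = branch
    (record
      { label>0   = label≥0 root , λ 0≈Γ → contradiction (Equivalence.to (label≈0⇔leaf root) (sym 0≈Γ)) λ ()
      ; degree≥2  = degree≥2 root λ ()
      ; degree≤   = ℕ.≤-trans (base≤foldr⊔ (suc m) (λ i → maxDegree (ts i))) maxDegree≤
      ; antitone  = λ i → ≤-trans (≤-reflexive (rootLabel≈ (ts i) (subtree r i))) (label-antitone root i)
      ; separated = λ i → ≤-trans (≤-reflexive (*-congˡ (rootLabel≈ (ts i) (subtree r i)))) (label-separated root i)
      ; diameter  = λ x∈ y∈ → diam (∈-hierarchy⁻ t ρ x∈) (∈-hierarchy⁻ t ρ y∈)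
      ; split     = λ {i} {j} i≢j x∈ y∈ →
                      far i≢j (∈-hierarchy⁻ (ts i) (restrict ρ i) x∈) (∈-hierarchy⁻ (ts j) (restrict ρ j) y∈)
      })
    (λ i → hierarchy-valid (ts i) (subtree r i))
    where
    open Represents r
    diam : ∀ {x y} → (∃ λ u → ρ u ≡ x) → (∃ λ v → ρ v ≡ y) → d x y ≤ Γ
    diam (u , ≡.refl) (v , ≡.refl) = ≤-trans (≤-reflexive (d≈label-lca u v)) (label≤root t r (lca (proj₁ u) (proj₁ v)))
    far : ∀ {i j x y} → i ≢ j → (∃ λ u → restrict ρ i u ≡ x) → (∃ λ v → restrict ρ j v ≡ y) → Γ ≤ d x y
    far {i} {j} i≢j ((u , lu) , ≡.refl) ((v , lv) , ≡.refl) = ≤-reflexive (sym (trans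
      (d≈label-lca (child i u , lu) (child j v , lv)) (reflexive (cong label (lca-distinct i≢j u v)))))

  points-unique : ∀ {t} → Valid k δ t → Unique (points t)
  points-unique leaf = All.[] ∷ []
  points-unique {branch Γ m ts} (branch v vs) = Unique.concat⁺
    (All.map⁺ (All.universal (λ i → points-unique (vs i)) (allFin (suc m))))
    (AllPairs.map⁺ (AllPairs.map (λ i≢j {_} (x∈i , x∈j) → ValidBranch.disjoint v i≢j x∈i x∈j) (Unique.allFin⁺ (suc m))))

  points-↭ : ∀ {t} → Valid k δ t → (∀ x → x ∈ points t) → points t ↭ allFin size
  points-↭ v total = ∼bag⇒↭ (unique∧set⇒bag (points-unique v) (Unique.allFin⁺ size)
    (mk⇔ (λ _ → ∈-allFin _) (λ _ → total _)))

  #points≡size : ∀ {t} → Valid k δ t → (∀ x → x ∈ points t) → #points t ≡ size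
  #points≡size v total = ≡.trans (↭-length (points-↭ v total)) (length-tabulate {n = size} id)

  count≡∣∣ : ∀ {t} → Valid k δ t → (∀ x → x ∈ points t) → ∀ B → count (Vec.lookup B) t ≡ ∣ B ∣
  count≡∣∣ v total B = ≡.trans (∑ℕ.∑-↭ _ (points-↭ v total)) (≡.sym (∣∣≡∑ B))

-- The distribution and its four properties.

m≤n⇒m∣n! : ∀ {m n} → m ℕ.≤ n → .{{ℕ.NonZero m}} → m ∣ n !
m≤n⇒m∣n! {suc m} m≤n = ∣-trans (m∣m*n (m !)) (m≤n⇒m!∣n! m≤n)

∈-sequences⇒length : ∀ N l {ω} → ω ∈ sequences N l → length ω ≡ l
∈-sequences⇒length N zero    (here ≡.refl) = ≡.refl
∈-sequences⇒length N (suc l) ω∈ with find (∈-concatMap⁻ (λ r → map (r ∷_) (sequences N l)) {xs = upTo N} ω∈)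
... | r , _ , ω∈r with ∈-map⁻ (r ∷_) ω∈r
...   | ω′ , ω′∈ , ≡.refl = cong suc (∈-sequences⇒length N l ω′∈)

module Theorem {c ℓ₁ ℓ₂} (ℝ : RealNumbers c ℓ₁ ℓ₂) where
  open RealNumbers ℝ hiding (zero)
  open Spanners ℝ
  open RealProperties ℝ
  open Graphs ℝ

  sum-const : ∀ m u → sum {m} (λ _ → u) ≈ fromℕ m * u
  sum-const zero    u = sym (zeroˡ u)
  sum-const (suc m) u = trans (+-cong (sym (*-identityˡ u)) (sum-const m u)) (sym (distribʳ u 1# (fromℕ m)))

  sum-lookup≤ : ∀ {a} {A : Set a} u (xs : List A) (f g : A → ℕ) → 0# ≤ u → (∀ x → f x ℕ.≤ g x) →
    sum (λ i → u * fromℕ (f (lookup xs i))) ≤ u * fromℕ (∑ℕ xs g)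
  sum-lookup≤ u []       f g 0≤u f≤g = ≤-reflexive (sym (zeroʳ u))
  sum-lookup≤ u (x ∷ xs) f g 0≤u f≤g = begin
    u * fromℕ (f x) + sum (λ i → u * fromℕ (f (lookup xs i)))
      ≤⟨ +-mono-≤ (*-monoʳ-≤ 0≤u (fromℕ-mono (f≤g x))) (sum-lookup≤ u xs f g 0≤u f≤g) ⟩
    u * fromℕ (g x) + u * fromℕ (∑ℕ xs g)
      ≈⟨ distribˡ u _ _ ⟨
    u * (fromℕ (g x) + fromℕ (∑ℕ xs g))
      ≈⟨ *-congˡ (fromℕ-+ (g x) (∑ℕ xs g)) ⟨
    u * fromℕ (g x ℕ.+ ∑ℕ xs g) ∎
    where open ≤-Reasoning

  weight≥0 : ∀ {n} (N : WeightedGraph n) → 0# ≤ weight N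
  weight≥0 N = ≤-trans
    (∑ℝ.∑-nonNegative (edges N) λ {(x , y)} e∈ → WeightedGraph.w≥0 N x y (∈-edges⁻ N e∈))
    (≤-reflexive (reflexive (≡.sym (weight≡∑ N))))

  module _ (k ν : Carrier) (1<k : 1# < k) (0<ν : 0# < ν) (ν<1/6 : ν < fromℕ 6 ⁻¹)
           (X : FiniteMetricSpace) (T : Tree) (isHST : IsHST k X T) where
    open FiniteMetricSpace X renaming (size to n)
    open Spanner ℝ X
    open IsHST isHST
    open IsUltrametric isUltrametric

    δ : ℕ
    δ = maxDegree T

    open FromTree ℝ X k δ

    H : Hier
    H = hierarchy T (Inverse.from φ)

    valid : Valid k δ H
    valid = hierarchy-valid T (record
      { label≥0         = label≥0
      ; label≈0⇔leaf    = label≈0⇔leaf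
      ; label-antitone  = label-antitone
      ; degree≥2        = degree≥2
      ; label-separated = label-separated
      ; d≈label-lca     = λ u v → trans (d≈label-lca (Inverse.from φ u) (Inverse.from φ v))
          (reflexive (cong₂ (λ u v → label (lca (proj₁ u) (proj₁ v))) (Inverse.strictlyInverseˡ φ u) (Inverse.strictlyInverseˡ φ v)))
      ; maxDegree≤      = ℕ.≤-refl
      })

    ∈points : ∀ x → x ∈ points H
    ∈points x = subst (_∈ points H) (Inverse.strictlyInverseʳ φ x) (∈-hierarchy⁺ T (Inverse.from φ) (Inverse.to φ x))

    open Estimates ℝ using (reciprocalBound; sampleCount≤)
    open Estimates.ReciprocalBound (reciprocalBound n ν 0<ν ν<1/6)

    instance
      p-nonZero : ℕ.NonZero p
      p-nonZero = p≢0

      n₃-nonZero : ℕ.NonZero (n ℕ.⊔ 3)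
      n₃-nonZero = ℕ.>-nonZero (ℕ.≤-trans (s≤s z≤n) (ℕ.m≤n⊔m n 3))

    -- The maximum with 3 agrees with `loglog`, so that the estimates apply to small spaces as well.
    sc : SampleCount p (n ℕ.⊔ 3)
    sc = sampleCount p (n ℕ.⊔ 3)

    open SampleCount sc using (l; D; class<D; enough)

    -- n ! is a common multiple of the sizes of all subtrees.
    Ω : List (List ℕ)
    Ω = sequences (n !) (suc l)

    spanner : List ℕ → WeightedGraph n
    spanner ω = DistanceGraph.distanceGraph X (Net.pairs (suc p) ω H) (Net.pairs-sym (suc p) ω H)

    instance
      Ω-nonZero : ℕ.NonZero (length Ω)
      Ω-nonZero = subst ℕ.NonZero (≡.sym (length-sequences (n !) (suc l))) (ℕ.m^n≢0 (n !) (suc l) {{n ℕ.!≢0}})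

    S u : Carrier
    S = fromℕ (length Ω)
    u = S ⁻¹

    -- Uniform over sample sequences; a graph arising from several of them is listed as often.
    𝒟 : Distribution n
    𝒟 = record
      { supportSize = length Ω
      ; graph       = λ i → spanner (lookup Ω i)
      ; prob        = λ _ → u
      ; prob>0      = λ _ → 0<⁻¹ (0<fromℕ (length Ω))
      ; prob-total  = trans (sum-const (length Ω) u) (⁻¹-inverseʳ S (<⇒≉0 (0<fromℕ (length Ω))))
      }

    module _ (B : Subset n) where
      open Covering {L = Carrier} p (Vec.lookup B) using (covered; ∑-covered≤)

      B⁺ : List ℕ → Subset n
      B⁺ ω = fromList (covered ω H)

      B⊆B⁺ : ∀ ω → B Subset.⊆ B⁺ ω
      B⊆B⁺ ω {x} x∈B = ∈⇒∈-fromList (Reliability.covered⊇B ℝ X k 1<k δ p ω H B H (∈points x) (Vec.[]=⇒lookup x∈B))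

      totalCovered : ℕ
      totalCovered = ∑ℕ Ω (λ ω → length (covered ω H))

      totalCovered≤ : p ℕ.* totalCovered ℕ.≤ length Ω ℕ.* ((3 ℕ.+ p) ℕ.* ∣ B ∣)
      totalCovered≤ = transport (∑-covered≤ (n !) l D enough H
        (λ s≤ → m≤n⇒m∣n! (ℕ.≤-trans s≤ (ℕ.≤-reflexive #H≡n)))
        (class<D (ℕ.≤-trans (ℕ.≤-reflexive #H≡n) (ℕ.m≤m⊔n n 3)) {{size≢0 H}}))
        where
        #H≡n = #points≡size valid ∈points
        transport : p ℕ.* totalCovered ℕ.≤ (n !) ℕ.^ suc l ℕ.* ((3 ℕ.+ p) ℕ.* count (Vec.lookup B) H) →
                  p ℕ.* totalCovered ℕ.≤ length Ω ℕ.* ((3 ℕ.+ p) ℕ.* ∣ B ∣)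
        transport le rewrite length-sequences (n !) (suc l) | count≡∣∣ valid ∈points B = le

      expectation≤ : Distribution.expectation 𝒟 (λ i → fromℕ ∣ B⁺ (lookup Ω i) ∣) ≤ (1# + ν) * fromℕ ∣ B ∣
      expectation≤ = ≤-trans (sum-lookup≤ u Ω (∣_∣ ∘ B⁺) _ (0≤⁻¹ 0<S) (λ ω → ∣fromList∣≤ (covered ω H)))
        -- Multiplication by p and by the size of the sample space reduces the expectation to the
        -- integer count `totalCovered≤`.
        (*-cancelˡ-≤ (*-positive (0<fromℕ p) 0<S) (begin
          P * S * (u * V)
            ≈⟨ solve 4 (λ P S u V → P :* S :* (u :* V) := S :* u :* (P :* V)) refl P S u V ⟩
          S * u * (P * V)
            ≈⟨ *-congʳ (⁻¹-inverseʳ S (<⇒≉0 0<S)) ⟩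
          1# * (P * V)
            ≈⟨ *-identityˡ _ ⟩
          P * V
            ≈⟨ fromℕ-* p totalCovered ⟨
          fromℕ (p ℕ.* totalCovered)
            ≤⟨ fromℕ-mono totalCovered≤ ⟩
          fromℕ (length Ω ℕ.* ((3 ℕ.+ p) ℕ.* ∣ B ∣))
            ≈⟨ trans (fromℕ-* (length Ω) _) (*-congˡ (trans (fromℕ-* (3 ℕ.+ p) ∣ B ∣) (*-congʳ (fromℕ-+ 3 p)))) ⟩
          S * ((fromℕ 3 + P) * b)
            -- The choice of `p` enters here: 3 + p is at most p(1 + ν).
            ≤⟨ *-monoʳ-≤ (proj₁ 0<S) (*-monoˡ-≤ (0≤fromℕ ∣ B ∣) (+-monoˡ-≤ _ _ P 3≤pν)) ⟩
          S * ((P * ν + P) * b)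
            ≈⟨ solve 4 (λ P S ν b → S :* ((P :* ν :+ P) :* b) := P :* S :* ((con 1 :+ ν) :* b)) refl P S ν b ⟩
          P * S * ((1# + ν) * b) ∎))
        where
        open ≤-Reasoning
        P = fromℕ p
        V = fromℕ totalCovered
        b = fromℕ ∣ B ∣
        0<S : 0# < S
        0<S = 0<fromℕ (length Ω)

    isReliable : IsObliviousReliableSpanner X ν (1# + fromℕ 2 * (k - 1#) ⁻¹) 𝒟
    isReliable = record
      { dominating = λ i → DistanceGraph.distanceGraph-dominating X _ (Net.pairs-sym (suc p) (lookup Ω i) H)
      ; reliable   = λ B → (λ i → B⁺ B (lookup Ω i)) , (λ i → B⊆B⁺ B (lookup Ω i)) ,
          (λ i x y x∉ y∉ → Reliability.connect ℝ X k 1<k δ p (lookup Ω i) H B valid id (∈points x) (∈points y)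
             (x∉ ∘ ∈⇒∈-fromList) (y∉ ∘ ∈⇒∈-fromList)) ,
          expectation≤ B
      }

    s Q bound : Carrier
    s     = ν ⁻¹ * loglog n
    Q     = Õ[ 800 , 1 ] s
    bound = fromℕ δ * Q ^ 2

    -- The 16 is the 4 in `unit` times the 4 of `labelSum≤weight`. Being a square, it moves into the
    -- squared factor as 4, which together with the 200 of `sampleCount≤` gives the constant 800.
    unit≤bound : fromℕ (16 ℕ.* δ ℕ.* (suc l ℕ.* suc l)) ≤ bound
    unit≤bound = begin
      fromℕ (16 ℕ.* δ ℕ.* (suc l ℕ.* suc l))
        ≡⟨ cong fromℕ (rearrange δ (suc l)) ⟩
      fromℕ (δ ℕ.* (4 ℕ.* suc l ℕ.* (4 ℕ.* suc l)))
        ≈⟨ trans (fromℕ-* δ _) (*-congˡ (fromℕ-* (4 ℕ.* suc l) (4 ℕ.* suc l))) ⟩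
      fromℕ δ * (fromℕ (4 ℕ.* suc l) * fromℕ (4 ℕ.* suc l))
        ≤⟨ *-monoʳ-≤ (0≤fromℕ δ) (*-mono-≤ (≤-trans (0≤fromℕ (4 ℕ.* suc l)) 4l≤Q) (0≤fromℕ (4 ℕ.* suc l)) 4l≤Q 4l≤Q) ⟩
      fromℕ δ * (Q * Q)
        ≈⟨ *-congˡ (*-congˡ (*-identityʳ Q)) ⟨
      bound ∎
      where
      open ≤-Reasoning
      rearrange : ∀ δ l → 16 ℕ.* δ ℕ.* (l ℕ.* l) ≡ δ ℕ.* (4 ℕ.* l ℕ.* (4 ℕ.* l))
      rearrange = solve-∀
      4l≤Q : fromℕ (4 ℕ.* suc l) ≤ Q
      4l≤Q = begin
        fromℕ (4 ℕ.* suc l)                          ≈⟨ fromℕ-* 4 (suc l) ⟩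
        fromℕ 4 * fromℕ (suc l)                      ≤⟨ *-monoʳ-≤ (0≤fromℕ 4) (sampleCount≤ n ν 0<ν ν<1/6 p p≤4y sc) ⟩
        fromℕ 4 * (fromℕ 200 * s * log₂ s)           ≈⟨ *-assoc _ _ _ ⟨
        fromℕ 4 * (fromℕ 200 * s) * log₂ s           ≈⟨ *-congʳ (*-assoc _ _ _) ⟨
        fromℕ 4 * fromℕ 200 * s * log₂ s             ≈⟨ *-cong (*-congʳ (fromℕ-* 4 200)) (*-identityʳ _) ⟨
        Q                                            ∎

    length-Ω∈ : ∀ i → length (lookup Ω i) ≡ suc l
    length-Ω∈ i = ∈-sequences⇒length (n !) (suc l) (∈-lookup {xs = Ω} i)

    unit≡ : ∀ i → Net.unit (suc p) (lookup Ω i) δ ≡ 4 ℕ.* δ ℕ.* (suc l ℕ.* suc l)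
    unit≡ i = cong (λ l → 4 ℕ.* δ ℕ.* (l ℕ.* l)) (length-Ω∈ i)

    hasSize : HasSize≤ 𝒟 (fromℕ n * bound)
    hasSize i = begin
      fromℕ (edgeCount (spanner ω))
        ≤⟨ fromℕ-mono edgeCount≤pairs ⟩
      fromℕ (n ℕ.* (16 ℕ.* δ ℕ.* (suc l ℕ.* suc l)))
        ≈⟨ fromℕ-* n _ ⟩
      fromℕ n * fromℕ (16 ℕ.* δ ℕ.* (suc l ℕ.* suc l))
        ≤⟨ *-monoʳ-≤ (0≤fromℕ n) unit≤bound ⟩
      fromℕ n * bound ∎
      where
      ω = lookup Ω i
      rearrange : ∀ δ L n → 2 ℕ.* (4 ℕ.* δ ℕ.* L) ℕ.* n ℕ.+ 2 ℕ.* (4 ℕ.* δ ℕ.* L) ℕ.* n ≡ n ℕ.* (16 ℕ.* δ ℕ.* L)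
      rearrange = solve-∀
      edgeCount≤pairs : edgeCount (spanner ω) ℕ.≤ n ℕ.* (16 ℕ.* δ ℕ.* (suc l ℕ.* suc l))
      edgeCount≤pairs = begin
        edgeCount (spanner ω)
          ≤⟨ DistanceGraph.edgeCount≤ X _ (Net.pairs-sym (suc p) ω H) ⟩
        length (Net.pairs (suc p) ω H)
          ≤⟨ ℕ.m+n≤o⇒m≤o _ (Net.length-pairs≤ (suc p) ω δ valid) ⟩
        2 ℕ.* Net.unit (suc p) ω δ ℕ.* #points H
          ≡⟨ cong₂ (λ U n → 2 ℕ.* U ℕ.* n) (unit≡ i) (#points≡size valid ∈points) ⟩
        2 ℕ.* (4 ℕ.* δ ℕ.* (suc l ℕ.* suc l)) ℕ.* n
          -- The count yields only 8; it is doubled to share `unit≤bound` with the lightness.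
          ≤⟨ ℕ.m≤m+n _ _ ⟩
        2 ℕ.* (4 ℕ.* δ ℕ.* (suc l ℕ.* suc l)) ℕ.* n ℕ.+ 2 ℕ.* (4 ℕ.* δ ℕ.* (suc l ℕ.* suc l)) ℕ.* n
          ≡⟨ rearrange δ (suc l ℕ.* suc l) n ⟩
        n ℕ.* (16 ℕ.* δ ℕ.* (suc l ℕ.* suc l)) ∎
        where open ℕ.≤-Reasoning
      open ≤-Reasoning

    hasLightness : HasLightness≤ X 𝒟 bound
    hasLightness i N (N-isSpanningTree , _) = begin
      weight (spanner ω)
        ≤⟨ DistanceGraph.weight≤ X _ (Net.pairs-sym (suc p) ω H) ⟩
      ∑ℝ (Net.pairs (suc p) ω H) dist
        ≤⟨ Lightness.pairs-weight≤ ℝ X k δ (suc p) ω valid ⟩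
      fromℕ (Net.unit (suc p) ω δ) * labelSum H
        ≤⟨ *-monoʳ-≤ (0≤fromℕ (Net.unit (suc p) ω δ)) (Lightness.labelSum≤weight ℝ X k δ N-isSpanningTree valid ∈points) ⟩
      fromℕ (Net.unit (suc p) ω δ) * (fromℕ 4 * weight N)
        ≈⟨ *-assoc _ _ _ ⟨
      fromℕ (Net.unit (suc p) ω δ) * fromℕ 4 * weight N
        ≈⟨ *-congʳ (fromℕ-* (Net.unit (suc p) ω δ) 4) ⟨
      fromℕ (Net.unit (suc p) ω δ ℕ.* 4) * weight N
        ≡⟨ cong (λ m → fromℕ m * weight N) (≡.trans (cong (ℕ._* 4) (unit≡ i)) (rearrange δ (suc l ℕ.* suc l))) ⟩
      fromℕ (16 ℕ.* δ ℕ.* (suc l ℕ.* suc l)) * weight N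
        ≤⟨ *-monoˡ-≤ (weight≥0 N) unit≤bound ⟩
      bound * weight N ∎
      where
      open ≤-Reasoning
      ω = lookup Ω i
      rearrange : ∀ δ L → 4 ℕ.* δ ℕ.* L ℕ.* 4 ≡ 16 ℕ.* δ ℕ.* L
      rearrange = solve-∀

theorem2 : ∀ {c ℓ₁ ℓ₂} (ℝ : RealNumbers c ℓ₁ ℓ₂) →
    let open RealNumbers ℝ
        open Spanners ℝ
    in
    Σ ℕ λ C → Σ ℕ λ e →
    (k ν : Carrier) → 1# < k → 0# < ν → ν < fromℕ 6 ⁻¹ →
    (X : FiniteMetricSpace) (T : Tree) → IsHST k X T →
    let n     = FiniteMetricSpace.size X
        δ     = fromℕ (maxDegree T)
        bound = δ * Õ[ C , e ] (ν ⁻¹ * loglog n) ^ 2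
    in
    Σ (Distribution n) λ D →
      IsObliviousReliableSpanner X ν (1# + fromℕ 2 * (k - 1#) ⁻¹) D ×
      HasSize≤ D (fromℕ n * bound) ×
      HasLightness≤ X D bound
theorem2 ℝ = 800 , 1 , λ k ν 1<k 0<ν ν<1/6 X T isHST →
  𝒟 k ν 1<k 0<ν ν<1/6 X T isHST , isReliable k ν 1<k 0<ν ν<1/6 X T isHST ,
  hasSize k ν 1<k 0<ν ν<1/6 X T isHST , hasLightness k ν 1<k 0<ν ν<1/6 X T isHST
  where open Theorem ℝ
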